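{- For every integer $k\ge3$ and every $\varepsilon>0$, $$\lim_{j\to\infty}\frac{\#\{m\in\{1,\dots,j\}:\ \rho_k(m)>\varepsilon\}}{j}=0.$$
   Context: $c_i(G)$ is the number of $i$-vertex cliques of a graph $G$; $\binom{n}{j}=0$ if $j>n$ or $j<0$. For a positive integer $m$, its canonical representation is the unique $m=\sum_{i=0}^s\binom{n_{k-i}}{k-i}$ with $n_k>n_{k-1}>\dots>n_{k-s}\ge k-s>0$; set $\mathrm{KK}_k(m)=\sum_{i=0}^s\binom{n_{k-i}}{k+1-i}$. The second representation is the unique $m=\binom{n_k}{k}+\binom{n_{k-1}}{k-1}+\sum_{i=1}^{t}\binom{a_{k-i}}{k-i}$ with $t\ge0$, $n_k>n_{k-1}\ge k-2$, $a_{k-1}>\dots>a_{k-t}\ge k-t>0$ and $\binom{n_{k-1}}{k-2}>\sum_{i=1}^t\binom{a_{k-i}}{k-i}$; set $\mathrm{LG}_k(m)=\binom{n_k}{k+1}+\binom{n_{k-1}}{k}+\sum_{i=1}^t\binom{a_{k-i}}{k-i+1}$. Let $\mathrm{CON}_k(m)$ be the largest number of $(k+1)$-cliques a finite simple graph with exactly $m$ $k$-cliques and at least one clique on $n_k$ vertices can have ($n_k$ the leading term above). Define $\rho_k(m)=\frac{\mathrm{LG}_k(m)-\mathrm{CON}_k(m)}{\mathrm{KK}_k(m)-\mathrm{CON}_k(m)}$ if $\mathrm{CON}_k(m)\ne\mathrm{KK}_k(m)$, and $\rho_k(m)=1$ otherwise. -}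

module Defs where

open import Data.Nat using (ℕ; zero; suc; _+_; _∸_; _≤_; _<_; _>_; _≥_)
open import Data.Nat.Combinatorics using (_C_)
open import Data.Bool using (Bool; true; false; _∧_; _∨_; not; if_then_else_)
open import Data.Fin using (Fin; _≟_)
open import Data.Vec using (Vec; []; _∷_; lookup)
open import Data.List using (List; []; _∷_; _++_; map; length; filter; allFin; upTo; foldr)
open import Data.Bool.ListAction using (all)
open import Data.Product using (Σ; ∃; _×_; _,_)
open import Data.Integer using (ℤ; +_; -[1+_]; +[1+_]) renaming (_-_ to _-ℤ_)
open import Data.Rational using (ℚ; _/_; -_; 1ℚ)
open import Data.Rational.Properties using (_<?_)
open import Relation.Nullary using (¬_; does)
open import Relation.Binary.PropositionalEquality using (_≡_; _≢_)

record Graph : Set where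
  field
    n     : ℕ
    adj   : Fin n → Fin n → Bool
    sym   : ∀ u v → adj u v ≡ adj v u
    irrfl : ∀ u → adj u u ≡ false
open Graph public

subsets : (n : ℕ) → List (Vec Bool n)
subsets zero = [] ∷ []
subsets (suc n) = map (true ∷_) (subsets n) ++ map (false ∷_) (subsets n)

card : ∀ {n} → Vec Bool n → ℕ
card [] = 0
card (true ∷ s) = suc (card s)
card (false ∷ s) = card s

isCliqueᵇ : (G : Graph) → Vec Bool (n G) → Bool
isCliqueᵇ G S =
  all (λ u → all (λ v →
        not (lookup S u ∧ lookup S v) ∨ does (u ≟ v) ∨ adj G u v)
      (allFin (n G))) (allFin (n G))

isICliqueᵇ : ℕ → (G : Graph) → Vec Bool (n G) → Bool
isICliqueᵇ i G S = isCliqueᵇ G S ∧ does (Data.Nat._≟_ (card S) i)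

c : ℕ → Graph → ℕ
c i G = length (filter (λ S → Data.Bool._≟_ (isICliqueᵇ i G S) true) (subsets (n G)))

HasClique : ℕ → Graph → Set
HasClique r G = Σ (Vec Bool (n G)) λ S → isICliqueᵇ r G S ≡ true

data Decr : List ℕ → Set where
  []  : Decr []
  [_] : ∀ a → Decr (a ∷ [])
  _∷_ : ∀ {a b l} → a > b → Decr (b ∷ l) → Decr (a ∷ b ∷ l)

-- last element lower bound: for list [x_r, x_{r-1}, ..., x_{r-s}]
-- (top index r), the last entry is ≥ r - s
LastGe : ℕ → List ℕ → Set
LastGe r [] = Data.Unit.⊤ where import Data.Unit
LastGe r (a ∷ []) = a ≥ r
LastGe r (a ∷ b ∷ l) = LastGe (r ∸ 1) (b ∷ l)

-- Σ_i binom(x_{r-i}, r-i + d) for list [x_r, x_{r-1}, ...]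
repSum : ℕ → ℕ → List ℕ → ℕ
repSum d r [] = 0
repSum d r (a ∷ l) = a C (r + d) + repSum d (r ∸ 1) l

-- canonical (k-binomial) representation:
-- m = Σ_{i=0}^s binom(n_{k-i}, k-i), n_k > ... > n_{k-s} ≥ k-s > 0
CanonRep : ℕ → ℕ → List ℕ → Set
CanonRep k m ns =
  1 ≤ length ns × length ns ≤ k × Decr ns × LastGe k ns × m ≡ repSum 0 k ns

IsKK : ℕ → ℕ → ℕ → Set
IsKK k m v = Σ (List ℕ) λ ns → CanonRep k m ns × v ≡ repSum 1 k ns

-- second representation:
-- m = binom(n_k,k) + binom(n_{k-1},k-1) + Σ_{i=1}^t binom(a_{k-i},k-i),
-- n_k > n_{k-1} ≥ k-2, a_{k-1} > ... > a_{k-t} ≥ k-t > 0,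
-- binom(n_{k-1},k-2) > Σ_{i=1}^t binom(a_{k-i},k-i)
SecondRep : ℕ → ℕ → ℕ → ℕ → List ℕ → Set
SecondRep k m nk nk1 as =
  nk > nk1 × nk1 ≥ k ∸ 2 × length as < k × Decr as × LastGe (k ∸ 1) as ×
  nk1 C (k ∸ 2) > repSum 0 (k ∸ 1) as ×
  m ≡ nk C k + nk1 C (k ∸ 1) + repSum 0 (k ∸ 1) as

IsLG : ℕ → ℕ → ℕ → Set
IsLG k m v = Σ ℕ λ nk → Σ ℕ λ nk1 → Σ (List ℕ) λ as →
  SecondRep k m nk nk1 as × v ≡ nk C (k + 1) + nk1 C k + repSum 1 (k ∸ 1) as

IsLead : ℕ → ℕ → ℕ → Set
IsLead k m nk = Σ ℕ λ nk1 → Σ (List ℕ) λ as → SecondRep k m nk nk1 as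

IsCON : ℕ → ℕ → ℕ → Set
IsCON k m v = Σ ℕ λ nk → IsLead k m nk ×
  (Σ Graph λ G → c k G ≡ m × HasClique nk G × c (suc k) G ≡ v) ×
  (∀ (G : Graph) → c k G ≡ m → HasClique nk G → c (suc k) G ≤ v)

ρ : ℕ → ℕ → ℕ → ℚ
ρ lg kk con with (+ kk) -ℤ (+ con)
... | + zero    = 1ℚ
... | +[1+ d ]  = ((+ lg) -ℤ (+ con)) / suc d
... | -[1+ d ]  = - (((+ lg) -ℤ (+ con)) / suc d)

countBig : (LG KK CON : ℕ → ℕ) → ℚ → ℕ → ℕ
countBig LG KK CON ε j =
  length (filter (λ m → ε <? ρ (LG m) (KK m) (CON m)) (map suc (upTo j)))

{-# OPTIONS --safe #-}

-- Write m = C(n,k) + C(b,k-1) + r as in the second representation and base = C(n,k+1) + C(b,k).  For most m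
-- the third entry s of the canonical representation is at least n/S, S a large constant, so r has order n^(k-2)
-- and KK - base ≥ C(s,k-1) has order n r.  It remains to see that LG and CON lie within o(n) r of base.
-- * LG - base is at most a r, where C(a,k-1) ≤ r forces a = o(n).
-- * CON ≥ base: take K_n, one vertex joined to b vertices of it and r vertices joined to k-1 vertices of it.
-- * CON ≤ base + o(n) r: in a graph containing a clique K of size n let v be a vertex outside K with the
--   largest number d of neighbours in K, and W = K ∪ {v}.  Outside W a weak Kruskal–Katona inequality bounds
--   the (k+1)-cliques that leave W by o(n) + max |N(w) ∩ W| / k times the k-cliques that leave W.  The
--   inequality then reduces to comparing d with b: if d is far below b the loss C(b,k) - C(d,k) dominates,
--   otherwise few k-cliques leave W and all |N(w) ∩ W| are o(n).
module Submission where

-- Cliques are counted as ordered tuples: such counts obey plain recursions over neighbourhoods,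
-- binomial coefficients turn into falling factorials, and no division occurs. The upper bound for
-- CON leaves no room for a constant factor in front of the number of neighbours in W. When d is a
-- fixed fraction of b near 1, the loss C(b,k) - C(d,k) pays for this number with coefficient 1 but
-- not with coefficient k. The saving comes from cliques with exactly one vertex outside W: in an
-- ordered k-clique that vertex may stand at any of k positions. The values of m with small s are
-- rare because (n, b, r) then has of order n^2 (n/S)^(k-2) choices, against order n^k values of m;
-- the exponent k-2 is at least 1 because k ≥ 3. The constants are fixed in this order: δ determines
-- S, and then S and ε determine how small a fraction of n each o(n) must be. Both ε and δ enter
-- through their denominators only, as lower bounds 1/E and 1/Δ. Existence of the representations is
-- supplied by the witnesses behind LG, KK and CON; what has to be proved is that their leading
-- terms agree.

module CliqueDensity where

  open import Defs hiding (sym)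
  import Data.Bool
  open import Data.Bool using (Bool; true; false; T; _∧_; _∨_; not)
  open import Data.Bool.ListAction using (all)
  open import Data.Bool.Properties using (∨-zeroʳ)
  import Data.Fin
  open import Data.Fin using (Fin; zero; suc)
  import Data.Integer
  open import Data.Integer using (+[1+_]; -[1+_]; +<+) renaming (+_ to pos; _-_ to _-ℤ_; _≤_ to _≤ℤ_)
  import Data.Integer.Properties as ℤ
  open import Data.List using (List; []; _∷_; _++_; map; length; filter; tabulate; upTo; cartesianProductWith)
  open import Data.List.Membership.Propositional using (_∈_)
  open import Data.List.Membership.Propositional.Properties
    using (∈-filter⁻; ∈-map⁻; ∈-upTo⁻; ∈-upTo⁺; ∈-++⁺ˡ; ∈-++⁺ʳ; ∈-++⁻; ∈-∃++; ∈-cartesianProductWith⁺)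
  open import Data.List.Properties using (length-++; length-map; length-upTo; filter-++)
  import Data.List.Relation.Unary.All as All
  open import Data.List.Relation.Unary.AllPairs using (_∷_)
  open import Data.List.Relation.Unary.Any using (here; there)
  open import Data.List.Relation.Unary.Unique.Propositional using (Unique)
  import Data.List.Relation.Unary.Unique.Propositional.Properties as Unique
  open import Data.Nat
  open import Data.Nat.Combinatorics using (_C_; nCk+nC[k+1]≡[n+1]C[k+1]; k>n⇒nCk≡0; nCn≡1)
  open import Data.Nat.Coprimality using (Coprime)
  open import Data.Nat.DivMod using (_/_; m≡m%n+[m/n]*n; m%n<n; m/n*n≤m; /-monoˡ-≤; m*n/n≡m)
  open import Data.Nat.Properties
  open import Algebra.Properties.Semiring.Sum +-*-semiring
    using (sum; sum-cong-≗; sum-replicate-zero; ∑-distrib-+; ∑-comm; *-distribˡ-sum)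
  open import Data.Nat.Tactic.RingSolver using (solve-∀)
  open import Data.Product using (∃; _×_; _,_; proj₁; proj₂)
  open import Data.Rational using (ℚ; mkℚ; 0ℚ; *<*) renaming (_<_ to _<ℚ_; _/_ to _/ℚ_)
  open import Data.Rational.Properties using (toℚᵘ-mono-<; toℚᵘ-cancel-<; toℚᵘ-fromℚᵘ) renaming (_<?_ to _<ℚ?_)
  open import Data.Rational.Unnormalised using (mkℚᵘ; *<*)
  import Data.Rational.Unnormalised.Properties as ℚᵘ
  open import Data.Sum using (_⊎_; inj₁; inj₂)
  open import Data.Unit using (tt)
  open import Data.Vec using (Vec; []; _∷_; lookup)
  open import Function using (_∘_; id)
  open import Relation.Binary.PropositionalEquality
    using (_≡_; _≢_; refl; sym; trans; cong; cong₂; subst; subst₂; module ≡-Reasoning)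
  open import Relation.Nullary using (¬_; yes; no; does; contradiction)
  open import Relation.Nullary.Decidable using (dec-true; dec-false)

  -- Sums over Fin n and ordered cliques

  sum-mono : ∀ {n} {f g : Fin n → ℕ} → (∀ v → f v ≤ g v) → sum f ≤ sum g
  sum-mono {zero}  f≤g = z≤n
  sum-mono {suc n} f≤g = +-mono-≤ (f≤g zero) (sum-mono (f≤g ∘ suc))

  term≤sum : ∀ {n} (f : Fin n → ℕ) v → f v ≤ sum f
  term≤sum f zero    = m≤m+n _ _
  term≤sum f (suc v) = ≤-trans (term≤sum (f ∘ suc) v) (m≤n+m _ _)

  sum-supported : ∀ {n} (f : Fin n → ℕ) v → (∀ u → u ≢ v → f u ≡ 0) → sum f ≡ f v
  sum-supported {suc n} f zero off = trans (cong (f zero +_) (trans (sum-cong-≗ (λ u → off (suc u) λ ())) (sum-replicate-zero n))) (+-identityʳ _)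
  sum-supported {suc n} f (suc v) off = trans (cong (_+ sum (f ∘ suc)) (off zero λ ()))
    (sum-supported (f ∘ suc) v (λ u u≢v → off (suc u) (λ { refl → u≢v refl })))

  infix 9 ⟦_⟧_
  ⟦_⟧_ : Bool → ℕ → ℕ
  ⟦ true ⟧ x = x
  ⟦ false ⟧ x = 0

  ⟦⟧-mono : ∀ b {x y} → (b ≡ true → x ≤ y) → ⟦ b ⟧ x ≤ ⟦ b ⟧ y
  ⟦⟧-mono true  h = h refl
  ⟦⟧-mono false h = z≤n

  ⟦⟧-sum : ∀ {n} b (f : Fin n → ℕ) → ⟦ b ⟧ sum f ≡ sum (λ v → ⟦ b ⟧ f v)
  ⟦⟧-sum true  f = refl
  ⟦⟧-sum {n} false f = sym (sum-replicate-zero n)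

  ⟦⟧-scale : ∀ b x y → ⟦ b ⟧ (x * y) ≡ x * ⟦ b ⟧ y
  ⟦⟧-scale true  x y = refl
  ⟦⟧-scale false x y = sym (*-zeroʳ x)

  ⟦⟧-swap : ∀ b c d e {x y} → (b ≡ true → c ≡ true → d ≡ true × e ≡ true × x ≤ y) → ⟦ b ⟧ ⟦ c ⟧ x ≤ ⟦ d ⟧ ⟦ e ⟧ y
  ⟦⟧-swap false c     d e h = z≤n
  ⟦⟧-swap true  false d e h = z≤n
  ⟦⟧-swap true  true  d e h with h refl refl
  ... | refl , refl , x≤y = x≤y

  -- Double counting of pairs, in which the masks and the summand may grow while the order of
  -- summation changes. It is used to exchange the first two entries of a tuple.
  sum-swap : ∀ {m n} (b : Fin m → Bool) (c : Fin m → Fin n → Bool) (d : Fin n → Bool) (e : Fin n → Fin m → Bool)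
    (f : Fin m → Fin n → ℕ) (g : Fin n → Fin m → ℕ) →
    (∀ w x → b w ≡ true → c w x ≡ true → d x ≡ true × e x w ≡ true × f w x ≤ g x w) →
    sum (λ w → ⟦ b w ⟧ sum (λ x → ⟦ c w x ⟧ f w x)) ≤ sum (λ x → ⟦ d x ⟧ sum (λ w → ⟦ e x w ⟧ g x w))
  sum-swap b c d e f g h = begin
    sum (λ w → ⟦ b w ⟧ sum (λ x → ⟦ c w x ⟧ f w x))
      ≡⟨ sum-cong-≗ (λ w → ⟦⟧-sum (b w) (λ x → ⟦ c w x ⟧ f w x)) ⟩
    sum (λ w → sum (λ x → ⟦ b w ⟧ ⟦ c w x ⟧ f w x))
      ≤⟨ sum-mono (λ w → sum-mono (λ x → ⟦⟧-swap (b w) (c w x) (d x) (e x w) (h w x))) ⟩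
    sum (λ w → sum (λ x → ⟦ d x ⟧ ⟦ e x w ⟧ g x w))
      ≡⟨ ∑-comm (λ w x → ⟦ d x ⟧ ⟦ e x w ⟧ g x w) ⟩
    sum (λ x → sum (λ w → ⟦ d x ⟧ ⟦ e x w ⟧ g x w))
      ≡⟨ sum-cong-≗ (λ x → ⟦⟧-sum (d x) (λ w → ⟦ e x w ⟧ g x w)) ⟨
    sum (λ x → ⟦ d x ⟧ sum (λ w → ⟦ e x w ⟧ g x w)) ∎
    where open ≤-Reasoning

  Mask : ℕ → Set
  Mask n = Fin n → Bool

  infixl 8 _∩_ _∖_
  infix 4 _⊆_

  _∩_ _∖_ : ∀ {n} → Mask n → Mask n → Mask n
  (A ∩ B) v = A v ∧ B v
  (A ∖ B) v = A v ∧ not (B v)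

  _⊆_ : ∀ {n} → Mask n → Mask n → Set
  A ⊆ B = ∀ v → A v ≡ true → B v ≡ true

  ∧-intro : ∀ {a b} → a ≡ true → b ≡ true → a ∧ b ≡ true
  ∧-intro refl refl = refl

  ∧-left : ∀ {a b} → a ∧ b ≡ true → a ≡ true
  ∧-left {true} _ = refl

  ∧-right : ∀ {a b} → a ∧ b ≡ true → b ≡ true
  ∧-right {true} h = h

  ∩-monoˡ : ∀ {n} {A B : Mask n} Γ → A ⊆ B → A ∩ Γ ⊆ B ∩ Γ
  ∩-monoˡ Γ A⊆B v h = ∧-intro (A⊆B v (∧-left h)) (∧-right h)

  ∩-swap : ∀ {n} (A B Γ : Mask n) → A ∩ B ∩ Γ ⊆ A ∩ Γ ∩ B
  ∩-swap A B Γ v with A v | B v | Γ v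
  ... | true | true | true = λ h → h

  ∩-lower : ∀ {n} (A B : Mask n) → A ∩ B ⊆ A
  ∩-lower A B v h = ∧-left h

  size : ∀ {n} → Mask n → ℕ
  size A = sum (λ v → ⟦ A v ⟧ 1)


  module Tuples {n : ℕ} (E : Fin n → Fin n → Bool) where

    -- t i A counts the ordered i-tuples of vertices of A spanning a clique, i.e. i! times the i-cliques in A.
    t : ℕ → Mask n → ℕ
    t zero    A = 1
    t (suc i) A = sum (λ v → ⟦ A v ⟧ t i (A ∩ E v))

    t-mono : ∀ i {A B} → A ⊆ B → t i A ≤ t i B
    t-mono zero    A⊆B = ≤-refl
    t-mono (suc i) {A} {B} A⊆B = sum-mono pointwise
      where
      pointwise : ∀ v → ⟦ A v ⟧ t i (A ∩ E v) ≤ ⟦ B v ⟧ t i (B ∩ E v)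
      pointwise v with A v in eq
      ... | false = z≤n
      ... | true rewrite A⊆B v eq = t-mono i (∩-monoˡ (E v) A⊆B)

    t-suc≤size : ∀ i A → t (suc i) A ≤ size A * t i A
    t-suc≤size i A = begin
      sum (λ v → ⟦ A v ⟧ t i (A ∩ E v))  ≤⟨ sum-mono (λ v → ⟦⟧-mono (A v) (λ _ → t-mono i (∩-lower A (E v)))) ⟩
      sum (λ v → ⟦ A v ⟧ t i A)          ≡⟨ sum-cong-≗ (λ v → trans (cong (⟦ A v ⟧_) (sym (*-identityʳ _))) (⟦⟧-scale (A v) (t i A) 1)) ⟩
      sum (λ v → t i A * ⟦ A v ⟧ 1)      ≡⟨ *-distribˡ-sum (t i A) (λ v → ⟦ A v ⟧ 1) ⟨
      t i A * size A                     ≡⟨ *-comm (t i A) (size A) ⟩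
      size A * t i A                     ∎
      where open ≤-Reasoning

    -- A weak Kruskal–Katona inequality.  Vertices lying in at most D^(j+1) of the tuples are handled by
    -- induction on their neighbourhoods; there are at most D other vertices.
    weak-KK : ∀ D .{{_ : NonZero D}} j A → t (suc j) A ≤ D ^ suc j → t (suc (suc j)) A ≤ suc j * D * t (suc j) A
    weak-KK D zero A h = begin
      t 2 A             ≤⟨ t-suc≤size 1 A ⟩
      size A * t 1 A    ≤⟨ *-monoˡ-≤ (t 1 A) (≤-trans h (≤-reflexive (*-identityʳ D))) ⟩
      D * t 1 A         ≡⟨ cong (_* t 1 A) (+-identityʳ D) ⟨
      1 * D * t 1 A     ∎
      where open ≤-Reasoning
    weak-KK D (suc j) A h = *-cancelˡ-≤ Q {{m^n≢0 D (suc j)}} (begin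
      Q * t (suc (suc (suc j))) A
        ≡⟨ *-distribˡ-sum Q (λ v → ⟦ A v ⟧ t (suc (suc j)) (A ∩ E v)) ⟩
      sum (λ v → Q * ⟦ A v ⟧ t (suc (suc j)) (A ∩ E v))
        ≡⟨ sum-cong-≗ (λ v → sym (⟦⟧-scale (A v) Q _)) ⟩
      sum (λ v → ⟦ A v ⟧ (Q * t (suc (suc j)) (A ∩ E v)))
        ≤⟨ sum-mono (λ v → ⟦⟧-mono (A v) (λ _ → pointwise v)) ⟩
      sum (λ v → ⟦ A v ⟧ (κ * t (suc j) (A ∩ E v)))
        ≡⟨ sum-cong-≗ (λ v → ⟦⟧-scale (A v) κ _) ⟩
      sum (λ v → κ * ⟦ A v ⟧ t (suc j) (A ∩ E v))
        ≡⟨ *-distribˡ-sum κ (λ v → ⟦ A v ⟧ t (suc j) (A ∩ E v)) ⟨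
      κ * x
        ≤⟨ *-monoˡ-≤ x (+-monoʳ-≤ (Q * (suc j * D)) h) ⟩
      (Q * (suc j * D) + D * Q) * x
        ≡⟨ ring Q D (suc j) x ⟩
      Q * (suc (suc j) * D * x) ∎)
      where
      open ≤-Reasoning
      Q = D ^ suc j
      x = t (suc (suc j)) A
      -- Adding the factors of the two cases gives one bound valid for every `v`, so the sum need
      -- not be split; the hypothesis then bounds `x` by `D * Q`.
      κ = Q * (suc j * D) + x
      ring : ∀ Q D i x → (Q * (i * D) + D * Q) * x ≡ Q * (suc i * D * x)
      ring = solve-∀
      pointwise : ∀ v → Q * t (suc (suc j)) (A ∩ E v) ≤ κ * t (suc j) (A ∩ E v)
      pointwise v with t (suc j) (A ∩ E v) ≤? Q
      ... | yes small = begin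
        Q * t (suc (suc j)) (A ∩ E v)             ≤⟨ *-monoʳ-≤ Q (weak-KK D j (A ∩ E v) small) ⟩
        Q * (suc j * D * t (suc j) (A ∩ E v))     ≡⟨ *-assoc Q (suc j * D) _ ⟨
        Q * (suc j * D) * t (suc j) (A ∩ E v)     ≤⟨ *-monoˡ-≤ (t (suc j) (A ∩ E v)) (m≤m+n (Q * (suc j * D)) x) ⟩
        κ * t (suc j) (A ∩ E v)                   ∎
      ... | no large = begin
        Q * t (suc (suc j)) (A ∩ E v)   ≤⟨ *-mono-≤ (≰⇒≥ large) (t-mono (suc (suc j)) (∩-lower A (E v))) ⟩
        t (suc j) (A ∩ E v) * x         ≡⟨ *-comm _ x ⟩
        x * t (suc j) (A ∩ E v)         ≤⟨ *-monoˡ-≤ (t (suc j) (A ∩ E v)) (m≤n+m x (Q * (suc j * D))) ⟩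
        κ * t (suc j) (A ∩ E v)         ∎

    -- Tuples relative to a vertex set `W`

    module Relative (E-sym : ∀ u v → E u v ≡ E v u) (W : Mask n) where

      -- A union bound: a tuple leaving `W` has an entry outside `W` at one of `suc i` positions,
      -- and symmetry of `E` allows that entry to be moved to the front.
      t-upper : ∀ i A → t (suc i) A ≤ t (suc i) (A ∩ W) + suc i * sum (λ w → ⟦ (A ∖ W) w ⟧ t i (A ∩ E w))
      t-upper zero A = begin
        sum (λ v → ⟦ A v ⟧ 1)                                       ≤⟨ sum-mono pointwise ⟩
        sum (λ v → ⟦ (A ∩ W) v ⟧ 1 + ⟦ (A ∖ W) v ⟧ 1)               ≡⟨ ∑-distrib-+ (λ v → ⟦ (A ∩ W) v ⟧ 1) (λ v → ⟦ (A ∖ W) v ⟧ 1) ⟩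
        t 1 (A ∩ W) + size (A ∖ W)                                  ≡⟨ cong (t 1 (A ∩ W) +_) (*-identityˡ (size (A ∖ W))) ⟨
        t 1 (A ∩ W) + 1 * size (A ∖ W)                              ∎
        where
        open ≤-Reasoning
        pointwise : ∀ v → ⟦ A v ⟧ 1 ≤ ⟦ (A ∩ W) v ⟧ 1 + ⟦ (A ∖ W) v ⟧ 1
        pointwise v with A v | W v
        ... | false | _     = z≤n
        ... | true  | true  = ≤-refl
        ... | true  | false = ≤-refl
      t-upper (suc i) A = begin
        sum (λ x → ⟦ A x ⟧ t (suc i) (A ∩ E x))
          ≤⟨ sum-mono pointwise ⟩
        sum (λ x → inner x + (suc i * cross x + outer x))
          ≡⟨ ∑-distrib-+ inner (λ x → suc i * cross x + outer x) ⟩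
        sum inner + sum (λ x → suc i * cross x + outer x)
          ≡⟨ cong (sum inner +_) (∑-distrib-+ (λ x → suc i * cross x) outer) ⟩
        sum inner + (sum (λ x → suc i * cross x) + sum outer)
          ≡⟨ cong (λ z → sum inner + (z + sum outer)) (*-distribˡ-sum (suc i) cross) ⟨
        sum inner + (suc i * sum cross + sum outer)
          ≤⟨ +-monoʳ-≤ (sum inner) (+-monoˡ-≤ (sum outer) (*-monoʳ-≤ (suc i) cross≤outer)) ⟩
        sum inner + (suc i * sum outer + sum outer)
          ≡⟨ cong (sum inner +_) (+-comm (suc i * sum outer) (sum outer)) ⟩
        sum inner + suc (suc i) * sum outer ∎
        where
        open ≤-Reasoning
        inner cross outer : Fin n → ℕ
        inner x = ⟦ (A ∩ W) x ⟧ t (suc i) (A ∩ W ∩ E x)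
        cross x = ⟦ (A ∩ W) x ⟧ sum (λ w → ⟦ (A ∩ E x ∖ W) w ⟧ t i (A ∩ E x ∩ E w))
        outer x = ⟦ (A ∖ W) x ⟧ t (suc i) (A ∩ E x)
        pointwise : ∀ x → ⟦ A x ⟧ t (suc i) (A ∩ E x) ≤ inner x + (suc i * cross x + outer x)
        pointwise x with A x | W x
        ... | false | _     = z≤n
        ... | true  | false = ≤-trans (m≤n+m _ (suc i * 0)) ≤-refl
        ... | true  | true  = ≤-trans (t-upper i (A ∩ E x))
          (+-mono-≤ (t-mono (suc i) (∩-swap A (E x) W)) (≤-reflexive (sym (+-identityʳ _))))
        cross≤outer : sum cross ≤ sum outer
        cross≤outer = sum-swap (A ∩ W) (λ x → A ∩ E x ∖ W) (A ∖ W) (λ w → A ∩ E w) _ _ λ x w x∈ w∈ →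
          ∧-intro (∧-left (∧-left w∈)) (∧-right {A w ∧ E x w} w∈) ,
          ∧-intro (∧-left x∈) (trans (E-sym w x) (∧-right {A w} (∧-left w∈))) ,
          t-mono i (∩-swap A (E x) (E w))

      -- The left side counts the tuples with at most one entry outside `W`; an only such entry has
      -- `suc i` possible positions, and the other entries lie in `W`.
      t-lower : ∀ i A → t (suc i) (A ∩ W) + suc i * sum (λ w → ⟦ (A ∖ W) w ⟧ t i (A ∩ E w ∩ W)) ≤ t (suc i) A
      t-lower zero A = begin
        t 1 (A ∩ W) + 1 * size (A ∖ W)                 ≡⟨ cong (t 1 (A ∩ W) +_) (*-identityˡ (size (A ∖ W))) ⟩
        t 1 (A ∩ W) + size (A ∖ W)                     ≡⟨ ∑-distrib-+ (λ v → ⟦ (A ∩ W) v ⟧ 1) (λ v → ⟦ (A ∖ W) v ⟧ 1) ⟨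
        sum (λ v → ⟦ (A ∩ W) v ⟧ 1 + ⟦ (A ∖ W) v ⟧ 1)  ≤⟨ sum-mono pointwise ⟩
        sum (λ v → ⟦ A v ⟧ 1)                          ∎
        where
        open ≤-Reasoning
        pointwise : ∀ v → ⟦ (A ∩ W) v ⟧ 1 + ⟦ (A ∖ W) v ⟧ 1 ≤ ⟦ A v ⟧ 1
        pointwise v with A v | W v
        ... | false | _     = z≤n
        ... | true  | true  = ≤-refl
        ... | true  | false = ≤-refl
      t-lower (suc i) A = begin
        sum inner + suc (suc i) * sum outer
          ≡⟨ cong (sum inner +_) (+-comm (sum outer) (suc i * sum outer)) ⟩
        sum inner + (suc i * sum outer + sum outer)
          ≤⟨ +-monoʳ-≤ (sum inner) (+-monoˡ-≤ (sum outer) (*-monoʳ-≤ (suc i) outer≤cross)) ⟩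
        sum inner + (suc i * sum cross + sum outer)
          ≡⟨ cong (λ z → sum inner + (z + sum outer)) (*-distribˡ-sum (suc i) cross) ⟩
        sum inner + (sum (λ x → suc i * cross x) + sum outer)
          ≡⟨ cong (sum inner +_) (∑-distrib-+ (λ x → suc i * cross x) outer) ⟨
        sum inner + sum (λ x → suc i * cross x + outer x)
          ≡⟨ ∑-distrib-+ inner (λ x → suc i * cross x + outer x) ⟨
        sum (λ x → inner x + (suc i * cross x + outer x))
          ≤⟨ sum-mono pointwise ⟩
        sum (λ x → ⟦ A x ⟧ t (suc i) (A ∩ E x)) ∎
        where
        open ≤-Reasoning
        inner cross outer : Fin n → ℕ
        inner x = ⟦ (A ∩ W) x ⟧ t (suc i) (A ∩ W ∩ E x)
        cross x = ⟦ (A ∩ W) x ⟧ sum (λ w → ⟦ (A ∩ E x ∖ W) w ⟧ t i (A ∩ E x ∩ E w ∩ W))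
        outer x = ⟦ (A ∖ W) x ⟧ t (suc i) (A ∩ E x ∩ W)
        pointwise : ∀ x → inner x + (suc i * cross x + outer x) ≤ ⟦ A x ⟧ t (suc i) (A ∩ E x)
        pointwise x with A x | W x
        ... | false | _     = ≤-reflexive (trans (+-identityʳ _) (*-zeroʳ i))
        ... | true  | false = ≤-trans (+-monoˡ-≤ _ (≤-reflexive (*-zeroʳ i))) (t-mono (suc i) (∩-lower (A ∩ E x) W))
        ... | true  | true  = ≤-trans
          (+-mono-≤ (t-mono (suc i) (∩-swap A W (E x))) (≤-reflexive (+-identityʳ _)))
          (t-lower i (A ∩ E x))
        outer≤cross : sum outer ≤ sum cross
        outer≤cross = sum-swap (A ∖ W) (λ w → A ∩ E w ∩ W) (A ∩ W) (λ x → A ∩ E x ∖ W) _ _ λ w x w∈ x∈ →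
          ∧-intro (∧-left (∧-left x∈)) (∧-right {A x ∧ E w x} x∈) ,
          ∧-intro (∧-intro (∧-left w∈) (trans (E-sym x w) (∧-right {A x} (∧-left x∈)))) (∧-right {A w} w∈) ,
          t-mono i (λ v h → ∩-monoˡ W (∩-swap A (E w) (E x)) v (∩-swap (A ∩ E w) W (E x) v h))

      -- Two disjoint classes of tuples: those inside `W` and those whose first entry is outside
      -- `W`.
      t-outside : ∀ i A → t (suc i) (A ∩ W) + sum (λ w → ⟦ (A ∖ W) w ⟧ t i (A ∩ E w)) ≤ t (suc i) A
      t-outside i A = begin
        t (suc i) (A ∩ W) + sum outer    ≡⟨ ∑-distrib-+ inner outer ⟨
        sum (λ w → inner w + outer w)    ≤⟨ sum-mono pointwise ⟩
        t (suc i) A                      ∎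
        where
        open ≤-Reasoning
        inner outer : Fin n → ℕ
        inner x = ⟦ (A ∩ W) x ⟧ t i (A ∩ W ∩ E x)
        outer x = ⟦ (A ∖ W) x ⟧ t i (A ∩ E x)
        pointwise : ∀ w → inner w + outer w ≤ ⟦ A w ⟧ t i (A ∩ E w)
        pointwise w with A w | W w
        ... | false | _     = z≤n
        ... | true  | false = ≤-refl
        ... | true  | true  = ≤-trans (≤-reflexive (+-identityʳ _)) (t-mono i (∩-monoˡ (E w) (∩-lower A W)))

      -- The number t i A − t i (A ∩ W) of tuples of A leaving W is monotone in A.
      t-leaving-mono : ∀ i {A B} → B ⊆ A → t i B + t i (A ∩ W) ≤ t i A + t i (B ∩ W)
      t-leaving-mono zero B⊆A = ≤-refl
      t-leaving-mono (suc i) {A} {B} B⊆A = begin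
        t (suc i) B + t (suc i) (A ∩ W)      ≡⟨ ∑-distrib-+ tB tAW ⟨
        sum (λ x → tB x + tAW x)             ≤⟨ sum-mono pointwise ⟩
        sum (λ x → tA x + tBW x)             ≡⟨ ∑-distrib-+ tA tBW ⟩
        t (suc i) A + t (suc i) (B ∩ W)      ∎
        where
        open ≤-Reasoning
        tB tAW tA tBW : Fin n → ℕ
        tB x = ⟦ B x ⟧ t i (B ∩ E x)
        tA x = ⟦ A x ⟧ t i (A ∩ E x)
        tAW x = ⟦ (A ∩ W) x ⟧ t i (A ∩ W ∩ E x)
        tBW x = ⟦ (B ∩ W) x ⟧ t i (B ∩ W ∩ E x)
        pointwise : ∀ x → tB x + tAW x ≤ tA x + tBW x
        pointwise x with B x in eqB | A x in eqA | W x
        ... | true  | false | _     = contradiction (trans (sym eqA) (B⊆A x eqB)) λ ()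
        ... | true  | true  | false = +-monoˡ-≤ 0 (t-mono i (∩-monoˡ (E x) B⊆A))
        ... | true  | true  | true  = ≤-trans (+-monoʳ-≤ (t i (B ∩ E x)) (t-mono i (∩-swap A W (E x))))
          (≤-trans (t-leaving-mono i (∩-monoˡ (E x) B⊆A)) (+-monoʳ-≤ (t i (A ∩ E x)) (t-mono i (∩-swap B (E x) W))))
        ... | false | false | _     = z≤n
        ... | false | true  | false = z≤n
        ... | false | true  | true  = ≤-trans (t-mono i (∩-monoˡ (E x) (∩-lower A W))) (m≤m+n _ 0)

      -- By `t-upper` only the links of the vertices `w` outside `W` matter. A link with at most
      -- `D ^ p` p-tuples falls to `weak-KK`. In any other link the tuples leaving `W` number at
      -- most `X`, which is at most `M` times the number `y w` of p-tuples there, and the tuples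
      -- inside `W` number at most `L * z w`.
      t-leaving-bound : ∀ o D .{{_ : NonZero D}} A X M L → let p = suc o in
        t (suc p) A ≡ t (suc p) (A ∩ W) + X → X ≤ M * D ^ p →
        (∀ w → (A ∖ W) w ≡ true → size (A ∩ E w ∩ W) ≤ L) →
        suc p * t (suc (suc p)) A ≤ suc p * t (suc (suc p)) (A ∩ W) + suc (suc p) * ((suc p * (p * D + M) + L) * X)
      t-leaving-bound o D A X M L hX hM hL = begin
        suc p * t (suc (suc p)) A
          ≤⟨ *-monoʳ-≤ (suc p) (t-upper (suc p) A) ⟩
        suc p * (t (suc (suc p)) (A ∩ W) + suc (suc p) * Y)
          ≡⟨ ring₁ (suc p) (t (suc (suc p)) (A ∩ W)) (suc (suc p)) Y ⟩
        suc p * t (suc (suc p)) (A ∩ W) + suc (suc p) * (suc p * Y)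
          ≤⟨ +-monoʳ-≤ (suc p * t (suc (suc p)) (A ∩ W)) (*-monoʳ-≤ (suc (suc p)) kY≤) ⟩
        suc p * t (suc (suc p)) (A ∩ W) + suc (suc p) * ((suc p * (p * D + M) + L) * X) ∎
        where
        open ≤-Reasoning
        p = suc o
        Q = D ^ p
        y z : Fin n → ℕ
        y w = t p (A ∩ E w)
        z w = t p (A ∩ E w ∩ W)
        Y S s₁ κ : ℕ
        Y  = sum (λ w → ⟦ (A ∖ W) w ⟧ t (suc p) (A ∩ E w))
        S  = sum (λ w → ⟦ (A ∖ W) w ⟧ y w)
        s₁ = sum (λ w → ⟦ (A ∖ W) w ⟧ z w)
        κ  = Q * (p * D) + X

        S≤X : S ≤ X
        S≤X = +-cancelˡ-≤ (t (suc p) (A ∩ W)) S X (≤-trans (t-outside p A) (≤-reflexive hX))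
        -- The gain over `S≤X`: the single entry outside `W` may stand at any of `suc p` positions.
        -- This keeps the factor `suc p` away from `L` in the conclusion.
        ks₁≤X : suc p * s₁ ≤ X
        ks₁≤X = +-cancelˡ-≤ (t (suc p) (A ∩ W)) _ X (≤-trans (t-lower p A) (≤-reflexive hX))

        ring₁ : ∀ a b c d → a * (b + c * d) ≡ a * b + c * (a * d)
        ring₁ = solve-∀
        ring₂ : ∀ Q a y z X L → Q * (a * y) + (X * y + Q * (L * z)) ≡ (Q * a + X) * y + Q * L * z
        ring₂ = solve-∀
        ring₃ : ∀ Q a M X L s → (Q * a + M * Q) * X + Q * L * s ≡ Q * ((a + M) * X + L * s)
        ring₃ = solve-∀
        ring₄ : ∀ k a X L s → k * (a * X + L * s) ≡ k * a * X + L * (k * s)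
        ring₄ = solve-∀

        leaving≤X : ∀ w → t (suc p) (A ∩ E w) ≤ X + t (suc p) (A ∩ E w ∩ W)
        leaving≤X w = +-cancelʳ-≤ (t (suc p) (A ∩ W)) _ _ (begin
          t (suc p) (A ∩ E w) + t (suc p) (A ∩ W)          ≤⟨ t-leaving-mono (suc p) (∩-lower A (E w)) ⟩
          t (suc p) A + t (suc p) (A ∩ E w ∩ W)            ≡⟨ cong (_+ t (suc p) (A ∩ E w ∩ W)) (trans hX (+-comm _ X)) ⟩
          X + t (suc p) (A ∩ W) + t (suc p) (A ∩ E w ∩ W)  ≡⟨ +-assoc X _ _ ⟩
          X + (t (suc p) (A ∩ W) + t (suc p) (A ∩ E w ∩ W)) ≡⟨ cong (X +_) (+-comm (t (suc p) (A ∩ W)) _) ⟩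
          X + (t (suc p) (A ∩ E w ∩ W) + t (suc p) (A ∩ W)) ≡⟨ +-assoc X _ _ ⟨
          X + t (suc p) (A ∩ E w ∩ W) + t (suc p) (A ∩ W)  ∎)

        pointwise : ∀ w → (A ∖ W) w ≡ true → Q * t (suc p) (A ∩ E w) ≤ κ * y w + Q * L * z w
        pointwise w w∈ with y w ≤? Q
        ... | yes small = begin
          Q * t (suc p) (A ∩ E w)           ≤⟨ *-monoʳ-≤ Q (weak-KK D o (A ∩ E w) small) ⟩
          Q * (p * D * y w)                 ≤⟨ m≤m+n _ _ ⟩
          Q * (p * D * y w) + (X * y w + Q * (L * z w)) ≡⟨ ring₂ Q (p * D) (y w) (z w) X L ⟩
          κ * y w + Q * L * z w             ∎
        ... | no large = begin
          Q * t (suc p) (A ∩ E w)           ≤⟨ *-monoʳ-≤ Q (leaving≤X w) ⟩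
          Q * (X + t (suc p) (A ∩ E w ∩ W)) ≡⟨ *-distribˡ-+ Q X _ ⟩
          Q * X + Q * t (suc p) (A ∩ E w ∩ W)
            ≤⟨ +-mono-≤ (≤-trans (*-monoˡ-≤ X (≰⇒≥ large)) (≤-reflexive (*-comm (y w) X)))
                        (*-monoʳ-≤ Q (≤-trans (t-suc≤size p (A ∩ E w ∩ W)) (*-monoˡ-≤ (z w) (hL w w∈)))) ⟩
          X * y w + Q * (L * z w)           ≤⟨ m≤n+m _ (Q * (p * D * y w)) ⟩
          Q * (p * D * y w) + (X * y w + Q * (L * z w)) ≡⟨ ring₂ Q (p * D) (y w) (z w) X L ⟩
          κ * y w + Q * L * z w             ∎

        scaled-terms : ∀ b c u d v → ⟦ b ⟧ (c * u + d * v) ≡ c * ⟦ b ⟧ u + d * ⟦ b ⟧ v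
        scaled-terms true  c u d v = refl
        scaled-terms false c u d v = sym (cong₂ _+_ (*-zeroʳ c) (*-zeroʳ d))

        QY≤ : Q * Y ≤ Q * ((p * D + M) * X + L * s₁)
        QY≤ = begin
          Q * Y
            ≡⟨ *-distribˡ-sum Q (λ w → ⟦ (A ∖ W) w ⟧ t (suc p) (A ∩ E w)) ⟩
          sum (λ w → Q * ⟦ (A ∖ W) w ⟧ t (suc p) (A ∩ E w))
            ≡⟨ sum-cong-≗ (λ w → ⟦⟧-scale ((A ∖ W) w) Q _) ⟨
          sum (λ w → ⟦ (A ∖ W) w ⟧ (Q * t (suc p) (A ∩ E w)))
            ≤⟨ sum-mono (λ w → ⟦⟧-mono ((A ∖ W) w) (pointwise w)) ⟩
          sum (λ w → ⟦ (A ∖ W) w ⟧ (κ * y w + Q * L * z w))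
            ≡⟨ sum-cong-≗ (λ w → scaled-terms ((A ∖ W) w) κ (y w) (Q * L) (z w)) ⟩
          sum (λ w → κ * ⟦ (A ∖ W) w ⟧ y w + Q * L * ⟦ (A ∖ W) w ⟧ z w)
            ≡⟨ ∑-distrib-+ (λ w → κ * ⟦ (A ∖ W) w ⟧ y w) (λ w → Q * L * ⟦ (A ∖ W) w ⟧ z w) ⟩
          sum (λ w → κ * ⟦ (A ∖ W) w ⟧ y w) + sum (λ w → Q * L * ⟦ (A ∖ W) w ⟧ z w)
            ≡⟨ cong₂ _+_ (*-distribˡ-sum κ (λ w → ⟦ (A ∖ W) w ⟧ y w)) (*-distribˡ-sum (Q * L) (λ w → ⟦ (A ∖ W) w ⟧ z w)) ⟨
          κ * S + Q * L * s₁
            ≤⟨ +-monoˡ-≤ (Q * L * s₁) (*-mono-≤ (+-monoʳ-≤ (Q * (p * D)) hM) S≤X) ⟩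
          (Q * (p * D) + M * Q) * X + Q * L * s₁
            ≡⟨ ring₃ Q (p * D) M X L s₁ ⟩
          Q * ((p * D + M) * X + L * s₁) ∎

        kY≤ : suc p * Y ≤ (suc p * (p * D + M) + L) * X
        kY≤ = begin
          suc p * Y                                  ≤⟨ *-monoʳ-≤ (suc p) (*-cancelˡ-≤ Q {{m^n≢0 D p}} QY≤) ⟩
          suc p * ((p * D + M) * X + L * s₁)         ≡⟨ ring₄ (suc p) (p * D + M) X L s₁ ⟩
          suc p * (p * D + M) * X + L * (suc p * s₁) ≤⟨ +-monoʳ-≤ (suc p * (p * D + M) * X) (*-monoʳ-≤ L ks₁≤X) ⟩
          suc p * (p * D + M) * X + L * X            ≡⟨ *-distribʳ-+ X (suc p * (p * D + M)) L ⟨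
          (suc p * (p * D + M) + L) * X              ∎

  -- Falling factorials

  F : ℕ → ℕ → ℕ
  F zero    x       = 1
  F (suc i) zero    = 0
  F (suc i) (suc x) = suc x * F i x

  F-pascal : ∀ i x → F (suc i) (suc x) ≡ F (suc i) x + suc i * F i x
  F-pascal zero    zero    = refl
  F-pascal zero    (suc x) = +-comm 1 (suc x * 1)
  F-pascal (suc i) zero    = sym (*-zeroʳ (suc (suc i)))
  F-pascal (suc i) (suc x) = begin
    suc (suc x) * u                                     ≡⟨⟩
    u + suc x * u                                       ≡⟨ cong (λ z → u + suc x * z) (F-pascal i x) ⟩
    u + suc x * (F (suc i) x + suc i * F i x)           ≡⟨ ring (suc x) (F (suc i) x) (suc i) (F i x) ⟩
    suc x * F (suc i) x + suc (suc i) * u               ∎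
    where
    open ≡-Reasoning
    u = suc x * F i x
    ring : ∀ y f i g → y * g + y * (f + i * g) ≡ y * f + suc i * (y * g)
    ring = solve-∀

  -- The rule F (suc i) x = (x - i) F i x without subtraction; for x < i both sides vanish.
  F-step : ∀ i x → F (suc i) x + i * F i x ≡ x * F i x
  F-step zero    zero    = refl
  F-step zero    (suc x) = +-identityʳ _
  F-step (suc i) zero    = *-zeroʳ (suc i)
  F-step (suc i) (suc x) = begin
    suc x * F (suc i) x + suc i * (suc x * F i x)  ≡⟨ ring (suc x) (F (suc i) x) (suc i) (F i x) ⟩
    suc x * (F (suc i) x + suc i * F i x)          ≡⟨ cong (suc x *_) (F-pascal i x) ⟨
    suc x * F (suc i) (suc x)                      ∎
    where
    open ≡-Reasoning
    ring : ∀ y f i g → y * f + i * (y * g) ≡ y * (f + i * g)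
    ring = solve-∀

  F-factor : ∀ i x → F (suc i) (i + x) ≡ x * F i (i + x)
  F-factor i x = +-cancelʳ-≡ (i * F i (i + x)) _ _
    (trans (F-step i (i + x)) (trans (*-distribʳ-+ (F i (i + x)) i x) (+-comm (i * F i (i + x)) _)))

  !*C≡F : ∀ i x → i ! * (x C i) ≡ F i x
  !*C≡F zero    x       = refl
  !*C≡F (suc i) zero    = trans (cong (suc i ! *_) (k>n⇒nCk≡0 {0} {suc i} (s≤s z≤n))) (*-zeroʳ (suc i !))
  !*C≡F (suc i) (suc x) = begin
    suc i ! * (suc x C suc i)                      ≡⟨ cong (suc i ! *_) (nCk+nC[k+1]≡[n+1]C[k+1] x i) ⟨
    suc i * i ! * (x C i + x C suc i)              ≡⟨ ring (suc i) (i !) (x C i) (x C suc i) ⟩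
    suc i ! * (x C suc i) + suc i * (i ! * (x C i)) ≡⟨ cong₂ (λ a b → a + suc i * b) (!*C≡F (suc i) x) (!*C≡F i x) ⟩
    F (suc i) x + suc i * F i x                    ≡⟨ F-pascal i x ⟨
    F (suc i) (suc x)                              ∎
    where
    open ≡-Reasoning
    ring : ∀ s f a b → s * f * (a + b) ≡ s * f * b + s * (f * a)
    ring = solve-∀

  F-mono : ∀ i {x y} → x ≤ y → F i x ≤ F i y
  F-mono zero    x≤y       = ≤-refl
  F-mono (suc i) z≤n       = z≤n
  F-mono (suc i) (s≤s x≤y) = *-mono-≤ (s≤s x≤y) (F-mono i x≤y)

  C-mono : ∀ i {x y} → x ≤ y → x C i ≤ y C i
  C-mono i {x} {y} x≤y = *-cancelˡ-≤ (i !) {{i !≢0}} (subst₂ _≤_ (sym (!*C≡F i x)) (sym (!*C≡F i y)) (F-mono i x≤y))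

  F≤^ : ∀ i x → F i x ≤ x ^ i
  F≤^ zero    x       = ≤-refl
  F≤^ (suc i) zero    = z≤n
  F≤^ (suc i) (suc x) = *-monoʳ-≤ (suc x) (≤-trans (F≤^ i x) (^-monoˡ-≤ i (n≤1+n x)))

  ^≤F : ∀ i x → x ^ i ≤ F i (x + i)
  ^≤F zero    x = ≤-refl
  ^≤F (suc i) x rewrite +-suc x i = *-mono-≤ (m≤n⇒m≤1+n (m≤m+n x i)) (^≤F i x)

  -- A mean value estimate: each unit step costs one application of `F-pascal`, and every difference
  -- is bounded by its value at the right end.
  F-increment : ∀ i d e → F (suc i) (d + e) ≤ F (suc i) d + e * (suc i * F i (d + e))
  F-increment i d zero rewrite +-identityʳ d = m≤m+n _ 0
  F-increment i d (suc e) rewrite +-suc d e = begin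
    F (suc i) (suc (d + e))                             ≡⟨ F-pascal i (d + e) ⟩
    F (suc i) (d + e) + suc i * F i (d + e)             ≤⟨ +-mono-≤ (F-increment i d e) (*-monoʳ-≤ (suc i) up) ⟩
    F (suc i) d + e * (suc i * F i (d + e)) + u         ≤⟨ +-monoˡ-≤ u (+-monoʳ-≤ (F (suc i) d) (*-monoʳ-≤ e (*-monoʳ-≤ (suc i) up))) ⟩
    F (suc i) d + e * u + u                             ≡⟨ ring (F (suc i) d) e u ⟩
    F (suc i) d + suc e * u                             ∎
    where
    open ≤-Reasoning
    u = suc i * F i (suc (d + e))
    up : F i (d + e) ≤ F i (suc (d + e))
    up = F-mono i (n≤1+n (d + e))
    ring : ∀ a e u → a + e * u + u ≡ a + suc e * u
    ring = solve-∀

  -- Trading falling factorials of degree p against those of degree p + 1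

  F-suc≤ : ∀ i ℓ e x → x ≤ i + (ℓ + e) → F (suc i) x ≤ (ℓ + e) * F i x
  F-suc≤ i ℓ e x h = +-cancelʳ-≤ (i * F i x) _ _ (begin
    F (suc i) x + i * F i x              ≡⟨ F-step i x ⟩
    x * F i x                            ≤⟨ *-monoˡ-≤ (F i x) h ⟩
    (i + (ℓ + e)) * F i x               ≡⟨ trans (*-distribʳ-+ (F i x) i (ℓ + e)) (+-comm (i * F i x) _) ⟩
    (ℓ + e) * F i x + i * F i x         ∎)
    where open ≤-Reasoning

  -- Since F (suc p) b = (b - p) F p b, write b - p as ℓ + f. The share ℓ absorbs `Z` through the
  -- hypothesis, and monotonicity of `F p` settles the share f.
  exchange-near : ∀ p d b ℓ Z R → d ≤ b → p + ℓ ≤ b → F p d + Z ≤ F p b + R →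
    F (suc p) d + ℓ * Z ≤ F (suc p) b + ℓ * R
  exchange-near p d b ℓ Z R d≤b p+ℓ≤b hZ = begin
    F (suc p) d + ℓ * Z             ≤⟨ +-monoˡ-≤ (ℓ * Z) (F-suc≤ p ℓ f d (≤-trans d≤b (≤-reflexive b≡))) ⟩
    (ℓ + f) * F p d + ℓ * Z         ≡⟨ ring₁ ℓ f (F p d) Z ⟩
    ℓ * (F p d + Z) + f * F p d     ≤⟨ +-mono-≤ (*-monoʳ-≤ ℓ hZ) (*-monoʳ-≤ f (F-mono p d≤b)) ⟩
    ℓ * (F p b + R) + f * F p b     ≡⟨ ring₂ ℓ f (F p b) R ⟩
    (ℓ + f) * F p b + ℓ * R         ≡⟨ cong (_+ ℓ * R) F-b ⟨
    F (suc p) b + ℓ * R             ∎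
    where
    open ≤-Reasoning
    f = b ∸ (p + ℓ)
    b≡ : b ≡ p + (ℓ + f)
    b≡ = trans (sym (m+[n∸m]≡n p+ℓ≤b)) (+-assoc p ℓ f)
    F-b : F (suc p) b ≡ (ℓ + f) * F p b
    F-b = subst (λ z → F (suc p) z ≡ (ℓ + f) * F p z) (sym b≡) (F-factor p (ℓ + f))
    ring₁ : ∀ ℓ f a z → (ℓ + f) * a + ℓ * z ≡ ℓ * (a + z) + f * a
    ring₁ = solve-∀
    ring₂ : ∀ ℓ f a z → ℓ * (a + z) + f * a ≡ (ℓ + f) * a + ℓ * z
    ring₂ = solve-∀

  -- The left side is at most ℓ (F p b + R), while F (suc p) b = (b - p) F p b. The slack b - p - ℓ
  -- is at least p, and p F p b swallows ℓ R because F p b ≥ ℓ F o b. So no error term survives.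
  exchange-far : ∀ o d b ℓ Z R → let p = suc o in d ≤ ℓ → ℓ + (p + p) ≤ b → F p d + Z ≤ F p b + R →
    R ≤ p * F o b → F (suc p) d + ℓ * Z ≤ F (suc p) b
  exchange-far o d b ℓ Z R d≤ℓ h hZ hR = begin
    F (suc p) d + ℓ * Z                ≤⟨ +-monoˡ-≤ (ℓ * Z) (F-suc≤ p ℓ 0 d (≤-trans d≤ℓ (≤-trans (≤-reflexive (sym (+-identityʳ ℓ))) (m≤n+m (ℓ + 0) p)))) ⟩
    (ℓ + 0) * F p d + ℓ * Z            ≡⟨ ring₀ ℓ (F p d) Z ⟩
    ℓ * (F p d + Z)                    ≤⟨ *-monoʳ-≤ ℓ (≤-trans hZ (+-monoʳ-≤ (F p b) hR)) ⟩
    ℓ * (F p b + p * F o b)            ≡⟨ ring₁ ℓ (F p b) p (F o b) ⟩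
    ℓ * F p b + p * (ℓ * F o b)        ≤⟨ +-monoʳ-≤ (ℓ * F p b) (*-mono-≤ (m≤m+n p f) (*-monoˡ-≤ (F o b) (m≤m+n ℓ (suc p + f)))) ⟩
    ℓ * F p b + (p + f) * ((ℓ + (suc p + f)) * F o b) ≡⟨ cong (λ z → ℓ * F p b + (p + f) * z) F-b ⟨
    ℓ * F p b + (p + f) * F p b        ≡⟨ *-distribʳ-+ (F p b) ℓ (p + f) ⟨
    (ℓ + (p + f)) * F p b              ≡⟨ F-b′ ⟨
    F (suc p) b                        ∎
    where
    open ≤-Reasoning
    p = suc o
    f = b ∸ (ℓ + (p + p))
    b≡ : b ≡ ℓ + (p + p) + f
    b≡ = sym (m+[n∸m]≡n h)
    b≡₁ : b ≡ o + (ℓ + (suc p + f))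
    b≡₁ = trans b≡ (ring ℓ o f)
      where
      ring : ∀ ℓ o f → ℓ + (suc o + suc o) + f ≡ o + (ℓ + (suc (suc o) + f))
      ring = solve-∀
    b≡₂ : b ≡ p + (ℓ + (p + f))
    b≡₂ = trans b≡ (ring ℓ p f)
      where
      ring : ∀ ℓ p f → ℓ + (p + p) + f ≡ p + (ℓ + (p + f))
      ring = solve-∀
    F-b : F p b ≡ (ℓ + (suc p + f)) * F o b
    F-b = subst (λ z → F p z ≡ (ℓ + (suc p + f)) * F o z) (sym b≡₁) (F-factor o (ℓ + (suc p + f)))
    F-b′ : F (suc p) b ≡ (ℓ + (p + f)) * F p b
    F-b′ = subst (λ z → F (suc p) z ≡ (ℓ + (p + f)) * F p z) (sym b≡₂) (F-factor p (ℓ + (p + f)))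
    ring₀ : ∀ ℓ a z → (ℓ + 0) * a + ℓ * z ≡ ℓ * (a + z)
    ring₀ = solve-∀
    ring₁ : ∀ ℓ a p c → ℓ * (a + p * c) ≡ ℓ * a + p * (ℓ * c)
    ring₁ = solve-∀

  -- Ordered cliques versus c

  Relation : ℕ → Set
  Relation n = Fin n → Fin n → Bool

  ⟦⟧-sum-const : ∀ {n} (A : Mask n) x → sum (λ v → ⟦ A v ⟧ x) ≡ size A * x
  ⟦⟧-sum-const A x = begin
    sum (λ v → ⟦ A v ⟧ x)      ≡⟨ sum-cong-≗ (λ v → trans (cong (⟦ A v ⟧_) (sym (*-identityʳ x))) (⟦⟧-scale (A v) x 1)) ⟩
    sum (λ v → x * ⟦ A v ⟧ 1)  ≡⟨ *-distribˡ-sum x (λ v → ⟦ A v ⟧ 1) ⟨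
    x * size A                 ≡⟨ *-comm x (size A) ⟩
    size A * x                 ∎
    where open ≡-Reasoning

  Complete : ∀ {n} → Relation n → Mask n → Set
  Complete E Γ = ∀ u v → Γ u ≡ true → Γ v ≡ true → u ≢ v → E u v ≡ true

  module _ {n} (E : Relation n) (E-irr : ∀ u → E u u ≡ false) where
    open Tuples E

    size-link : ∀ Γ → Complete E Γ → ∀ v → Γ v ≡ true → size Γ ≡ suc (size (Γ ∩ E v))
    size-link Γ K v v∈ = begin
      size Γ                                        ≡⟨ sum-cong-≗ pointwise ⟩
      sum (λ u → δ u + ⟦ (Γ ∩ E v) u ⟧ 1)           ≡⟨ ∑-distrib-+ δ (λ u → ⟦ (Γ ∩ E v) u ⟧ 1) ⟩
      sum δ + size (Γ ∩ E v)                        ≡⟨ cong (_+ size (Γ ∩ E v)) (trans (sum-supported δ v off) on) ⟩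
      suc (size (Γ ∩ E v))                          ∎
      where
      open ≡-Reasoning
      δ : Fin n → ℕ
      δ u = ⟦ does (u Data.Fin.≟ v) ⟧ 1
      off : ∀ u → u ≢ v → δ u ≡ 0
      off u u≢v with u Data.Fin.≟ v
      ... | yes u≡v = contradiction u≡v u≢v
      ... | no _    = refl
      on : δ v ≡ 1
      on rewrite dec-true (v Data.Fin.≟ v) refl = refl
      pointwise : ∀ u → ⟦ Γ u ⟧ 1 ≡ δ u + ⟦ (Γ ∩ E v) u ⟧ 1
      pointwise u with u Data.Fin.≟ v
      ... | yes refl rewrite v∈ | E-irr v = refl
      ... | no u≢v with Γ u in u∈
      ...   | false = refl
      ...   | true rewrite K v u v∈ u∈ (u≢v ∘ sym) = refl

    t-complete : ∀ i Γ → Complete E Γ → t i Γ ≡ F i (size Γ)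
    t-complete zero    Γ K = refl
    t-complete (suc i) Γ K = begin
      sum (λ v → ⟦ Γ v ⟧ t i (Γ ∩ E v))       ≡⟨ sum-cong-≗ pointwise ⟩
      sum (λ v → ⟦ Γ v ⟧ F i (pred (size Γ))) ≡⟨ ⟦⟧-sum-const Γ _ ⟩
      size Γ * F i (pred (size Γ))            ≡⟨ absorb (size Γ) ⟩
      F (suc i) (size Γ)                      ∎
      where
      open ≡-Reasoning
      absorb : ∀ s → s * F i (pred s) ≡ F (suc i) s
      absorb zero    = refl
      absorb (suc s) = refl
      pointwise : ∀ v → ⟦ Γ v ⟧ t i (Γ ∩ E v) ≡ ⟦ Γ v ⟧ F i (pred (size Γ))
      pointwise v with Γ v in v∈
      ... | false = refl
      ... | true  = trans
        (t-complete i (Γ ∩ E v) (λ u w u∈ w∈ → K u w (∧-left u∈) (∧-left w∈)))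
        (cong (F i ∘ pred) (sym (size-link Γ K v v∈)))

  down : ∀ {n} → Relation (suc n) → Relation n
  down E u v = E (suc u) (suc v)

  -- Unordered cliques, split by whether they contain the vertex `zero`. This recursion runs
  -- parallel to that of `subsets` and so mediates between `c` and the tuple counts `t`.
  cliques : ∀ {n} → ℕ → Relation n → Mask n → ℕ
  cliques         zero    E A = 1
  cliques {zero}  (suc i) E A = 0
  cliques {suc n} (suc i) E A = ⟦ A zero ⟧ cliques i (down E) ((A ∘ suc) ∩ (E zero ∘ suc)) + cliques (suc i) (down E) (A ∘ suc)

  cliques-cong : ∀ {n} i (E : Relation n) {A B : Mask n} → (∀ v → A v ≡ B v) → cliques i E A ≡ cliques i E B
  cliques-cong         zero    E A≗B = refl
  cliques-cong {zero}  (suc i) E A≗B = refl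
  cliques-cong {suc n} (suc i) E A≗B = cong₂ _+_
    (cong₂ ⟦_⟧_ (A≗B zero) (cliques-cong i (down E) (λ v → cong (_∧ E zero (suc v)) (A≗B (suc v)))))
    (cliques-cong (suc i) (down E) (A≗B ∘ suc))

  -- Both sides count pairs of a clique and one of its vertices. A clique through `zero` is counted
  -- once for `zero`, and its other vertices are handled by induction inside the neighbourhood of
  -- `zero`.
  cliques-handshake : ∀ {n} i (E : Relation n) → (∀ u v → E u v ≡ E v u) → (∀ u → E u u ≡ false) → ∀ A →
    suc i * cliques (suc i) E A ≡ sum (λ v → ⟦ A v ⟧ cliques i E (A ∩ E v))
  cliques-handshake {zero}  i E E-sym E-irr A = *-zeroʳ (suc i)
  cliques-handshake {suc n} zero E E-sym E-irr A = begin
    1 * cliques 1 E A                                ≡⟨ *-identityˡ _ ⟩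
    ⟦ A zero ⟧ 1 + cliques 1 (down E) (A ∘ suc)      ≡⟨ cong (⟦ A zero ⟧ 1 +_) (trans (sym (*-identityˡ _)) (cliques-handshake 0 (down E) (λ u v → E-sym _ _) (λ u → E-irr _) (A ∘ suc))) ⟩
    ⟦ A zero ⟧ 1 + sum (λ v → ⟦ A (suc v) ⟧ 1)       ∎
    where open ≡-Reasoning
  cliques-handshake {suc n} (suc j) E E-sym E-irr A = begin
    suc (suc j) * (⟦ a ⟧ x + y)
      ≡⟨ ring (suc j) (⟦ a ⟧ x) y ⟩
    ⟦ a ⟧ x + (suc j * ⟦ a ⟧ x + suc (suc j) * y)
      ≡⟨ cong (⟦ a ⟧ x +_) (cong₂ _+_ head-part (cliques-handshake (suc j) (down E) down-sym down-irr A′)) ⟩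
    ⟦ a ⟧ x + (sum (λ v → ⟦ A′ v ⟧ through v) + sum (λ v → ⟦ A′ v ⟧ cliques (suc j) (down E) (A′ ∩ down E v)))
      ≡⟨ cong (⟦ a ⟧ x +_) (∑-distrib-+ (λ v → ⟦ A′ v ⟧ through v) (λ v → ⟦ A′ v ⟧ cliques (suc j) (down E) (A′ ∩ down E v))) ⟨
    ⟦ a ⟧ x + sum (λ v → ⟦ A′ v ⟧ through v + ⟦ A′ v ⟧ cliques (suc j) (down E) (A′ ∩ down E v))
      ≡⟨ cong₂ _+_ (first a refl) (sum-cong-≗ (λ v → factor (A′ v) (through v) _)) ⟩
    ⟦ A zero ⟧ cliques (suc j) E (A ∩ E zero) + sum (λ v → ⟦ A′ v ⟧ cliques (suc j) E (A ∩ E (suc v))) ∎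
    where
    open ≡-Reasoning
    a = A zero
    A′ = A ∘ suc
    N₀ = E zero ∘ suc
    x = cliques (suc j) (down E) (A′ ∩ N₀)
    y = cliques (suc (suc j)) (down E) A′
    down-sym = λ u v → E-sym (suc u) (suc v)
    down-irr = λ u → E-irr (suc u)
    through : Fin n → ℕ
    through v = ⟦ a ∧ E (suc v) zero ⟧ cliques j (down E) (A′ ∩ down E v ∩ N₀)
    ring : ∀ s u y → suc s * (u + y) ≡ u + (s * u + suc s * y)
    ring = solve-∀
    factor : ∀ b u w → ⟦ b ⟧ u + ⟦ b ⟧ w ≡ ⟦ b ⟧ (u + w)
    factor true  u w = refl
    factor false u w = refl
    first : ∀ b → A zero ≡ b → ⟦ b ⟧ x ≡ ⟦ b ⟧ cliques (suc j) E (A ∩ E zero)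
    first false eq = refl
    first true  eq rewrite eq | E-irr zero = refl
    assoc-comm : ∀ a b c → (a ∧ b) ∧ c ≡ (a ∧ c) ∧ b
    assoc-comm false b c = refl
    assoc-comm true false false = refl
    assoc-comm true false true = refl
    assoc-comm true true false = refl
    assoc-comm true true true = refl
    head-part : suc j * ⟦ a ⟧ x ≡ sum (λ v → ⟦ A′ v ⟧ through v)
    head-part = begin
      suc j * ⟦ a ⟧ x
        ≡⟨ ⟦⟧-scale a (suc j) x ⟨
      ⟦ a ⟧ (suc j * x)
        ≡⟨ cong (⟦ a ⟧_) (cliques-handshake j (down E) down-sym down-irr (A′ ∩ N₀)) ⟩
      ⟦ a ⟧ sum (λ v → ⟦ A′ v ∧ N₀ v ⟧ cliques j (down E) (A′ ∩ N₀ ∩ down E v))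
        ≡⟨ ⟦⟧-sum a (λ v → ⟦ A′ v ∧ N₀ v ⟧ cliques j (down E) (A′ ∩ N₀ ∩ down E v)) ⟩
      sum (λ v → ⟦ a ⟧ ⟦ A′ v ∧ N₀ v ⟧ cliques j (down E) (A′ ∩ N₀ ∩ down E v))
        ≡⟨ sum-cong-≗ pointwise ⟩
      sum (λ v → ⟦ A′ v ⟧ through v) ∎
      where
      swapped : ∀ v → cliques j (down E) (A′ ∩ N₀ ∩ down E v) ≡ cliques j (down E) (A′ ∩ down E v ∩ N₀)
      swapped v = cliques-cong j (down E) (λ u → assoc-comm (A′ u) (N₀ u) (down E v u))
      pointwise : ∀ v → ⟦ a ⟧ ⟦ A′ v ∧ N₀ v ⟧ cliques j (down E) (A′ ∩ N₀ ∩ down E v) ≡ ⟦ A′ v ⟧ through v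
      pointwise v rewrite E-sym (suc v) zero = reorder a (A′ v) (N₀ v) (swapped v)
        where
        reorder : ∀ b c d {u w} → u ≡ w → ⟦ b ⟧ ⟦ c ∧ d ⟧ u ≡ ⟦ c ⟧ ⟦ b ∧ d ⟧ w
        reorder false false d e = refl
        reorder false true  d e = refl
        reorder true  false d e = refl
        reorder true  true  d e = cong (⟦ d ⟧_) e

  !*cliques≡t : ∀ {n} i (E : Relation n) → (∀ u v → E u v ≡ E v u) → (∀ u → E u u ≡ false) → ∀ A →
    i ! * cliques i E A ≡ Tuples.t E i A
  !*cliques≡t zero    E E-sym E-irr A = refl
  !*cliques≡t (suc i) E E-sym E-irr A = begin
    suc i * i ! * cliques (suc i) E A                          ≡⟨ ring (suc i) (i !) _ ⟩
    i ! * (suc i * cliques (suc i) E A)                        ≡⟨ cong (i ! *_) (cliques-handshake i E E-sym E-irr A) ⟩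
    i ! * sum (λ v → ⟦ A v ⟧ cliques i E (A ∩ E v))            ≡⟨ *-distribˡ-sum (i !) (λ v → ⟦ A v ⟧ cliques i E (A ∩ E v)) ⟩
    sum (λ v → i ! * ⟦ A v ⟧ cliques i E (A ∩ E v))            ≡⟨ sum-cong-≗ (λ v → trans (sym (⟦⟧-scale (A v) (i !) _)) (cong (⟦ A v ⟧_) (!*cliques≡t i E E-sym E-irr (A ∩ E v)))) ⟩
    sum (λ v → ⟦ A v ⟧ Tuples.t E i (A ∩ E v))                 ∎
    where
    open ≡-Reasoning
    ring : ∀ a b c → a * b * c ≡ b * (a * c)
    ring = solve-∀

  -- The Boolean clique test behind `c` and the recursive count

  everything : ∀ {n} → Mask n
  everything _ = true

  cliqueIn : ∀ {n} → Relation n → Mask n → ℕ → Vec Bool n → Bool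
  cliqueIn E A i       []          = does (0 Data.Nat.≟ i)
  cliqueIn E A i       (false ∷ S) = cliqueIn (down E) (A ∘ suc) i S
  cliqueIn E A zero    (true ∷ S)  = false
  cliqueIn E A (suc i) (true ∷ S)  = A zero ∧ cliqueIn (down E) ((A ∘ suc) ∩ (E zero ∘ suc)) i S

  count : ∀ {X : Set} → (X → Bool) → List X → ℕ
  count p xs = length (filter (λ x → p x Data.Bool.≟ true) xs)

  count-++ : ∀ {X : Set} (p : X → Bool) xs ys → count p (xs ++ ys) ≡ count p xs + count p ys
  count-++ p xs ys = trans (cong length (filter-++ (λ x → p x Data.Bool.≟ true) xs ys)) (length-++ (filter (λ x → p x Data.Bool.≟ true) xs))

  count-map : ∀ {X Y : Set} (p : Y → Bool) (f : X → Y) xs → count p (map f xs) ≡ count (p ∘ f) xs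
  count-map p f [] = refl
  count-map p f (x ∷ xs) with p (f x)
  ... | true  = cong suc (count-map p f xs)
  ... | false = count-map p f xs

  count-cong : ∀ {X : Set} {p q : X → Bool} → (∀ x → p x ≡ q x) → ∀ xs → count p xs ≡ count q xs
  count-cong p≗q [] = refl
  count-cong {p = p} {q} p≗q (x ∷ xs) with p x | q x | p≗q x
  ... | true  | _ | refl = cong suc (count-cong p≗q xs)
  ... | false | _ | refl = count-cong p≗q xs

  count-false : ∀ {X : Set} (xs : List X) → count (λ _ → false) xs ≡ 0
  count-false [] = refl
  count-false (x ∷ xs) = count-false xs

  count-∧ : ∀ {X : Set} b (p : X → Bool) xs → count (λ x → b ∧ p x) xs ≡ ⟦ b ⟧ count p xs
  count-∧ true  p xs = refl
  count-∧ false p xs = count-false xs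

  count-subsets : ∀ n (p : Vec Bool (suc n) → Bool) →
    count p (subsets (suc n)) ≡ count (p ∘ (true ∷_)) (subsets n) + count (p ∘ (false ∷_)) (subsets n)
  count-subsets n p = trans (count-++ p (map (true ∷_) (subsets n)) (map (false ∷_) (subsets n)))
    (cong₂ _+_ (count-map p (true ∷_) (subsets n)) (count-map p (false ∷_) (subsets n)))

  count-cliqueIn : ∀ {n} i (E : Relation n) A → count (cliqueIn E A i) (subsets n) ≡ cliques i E A
  count-cliqueIn {zero} zero E A = refl
  count-cliqueIn {zero} (suc i) E A = refl
  count-cliqueIn {suc n} zero E A = trans (count-subsets n (cliqueIn E A 0))
    (cong₂ _+_ (count-false (subsets n)) (count-cliqueIn 0 (down E) (A ∘ suc)))
  count-cliqueIn {suc n} (suc i) E A = trans (count-subsets n (cliqueIn E A (suc i)))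
    (cong₂ _+_
      (trans (count-∧ (A zero) _ (subsets n)) (cong (⟦ A zero ⟧_) (count-cliqueIn i (down E) _)))
      (count-cliqueIn (suc i) (down E) (A ∘ suc)))

  -- The common meaning of two Boolean tests: `isICliqueᵇ`, which runs over all pairs of vertices,
  -- and `cliqueIn`, which consumes the vector entry by entry.
  record SpansClique {n} (E : Relation n) (A : Mask n) (i : ℕ) (S : Vec Bool n) : Set where
    constructor spans
    field
      inside   : lookup S ⊆ A
      complete : Complete E (lookup S)
      has-card : card S ≡ i
  open SpansClique

  cliqueIn⇒spans : ∀ {n} (E : Relation n) → (∀ u v → E u v ≡ E v u) → ∀ A i S → cliqueIn E A i S ≡ true → SpansClique E A i S
  cliqueIn⇒spans E E-sym A zero [] h = spans (λ ()) (λ ()) refl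
  cliqueIn⇒spans E E-sym A (suc i) (true ∷ S) h = spans inside′ complete′ (cong suc (has-card ih))
    where
    ih = cliqueIn⇒spans (down E) (λ u v → E-sym _ _) ((A ∘ suc) ∩ (E zero ∘ suc)) i S (∧-right {A zero} h)
    inside′ : lookup (true ∷ S) ⊆ A
    inside′ zero    _ = ∧-left h
    inside′ (suc v) e = ∧-left (inside ih v e)
    complete′ : Complete E (lookup (true ∷ S))
    complete′ zero    zero    _ _ ne = contradiction refl ne
    complete′ zero    (suc v) _ e ne = ∧-right {A (suc v)} (inside ih v e)
    complete′ (suc u) zero    e _ ne = trans (E-sym _ _) (∧-right {A (suc u)} (inside ih u e))
    complete′ (suc u) (suc v) e f ne = complete ih u v e f (ne ∘ cong suc)
  cliqueIn⇒spans E E-sym A i (false ∷ S) h = spans inside′ complete′ (has-card ih)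
    where
    ih = cliqueIn⇒spans (down E) (λ u v → E-sym _ _) (A ∘ suc) i S h
    inside′ : lookup (false ∷ S) ⊆ A
    inside′ (suc v) e = inside ih v e
    complete′ : Complete E (lookup (false ∷ S))
    complete′ (suc u) (suc v) e f ne = complete ih u v e f (ne ∘ cong suc)

  spans⇒cliqueIn : ∀ {n} (E : Relation n) A i S → SpansClique E A i S → cliqueIn E A i S ≡ true
  spans⇒cliqueIn E A .0 [] (spans _ _ refl) = refl
  spans⇒cliqueIn E A .(suc (card S)) (true ∷ S) (spans ins com refl) = ∧-intro (ins zero refl)
    (spans⇒cliqueIn (down E) _ (card S) S (spans
      (λ v e → ∧-intro (ins (suc v) e) (com zero (suc v) refl e λ ()))
      (λ u v e f ne → com (suc u) (suc v) e f (λ { refl → ne refl })) refl))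
  spans⇒cliqueIn E A i (false ∷ S) (spans ins com eq) = spans⇒cliqueIn (down E) _ i S (spans
      (λ v e → ins (suc v) e)
      (λ u v e f ne → com (suc u) (suc v) e f (λ { refl → ne refl })) eq)

  all-tabulate⁻ : ∀ {X : Set} {n} (p : X → Bool) (f : Fin n → X) → all p (tabulate f) ≡ true → ∀ v → p (f v) ≡ true
  all-tabulate⁻ p f h zero    = ∧-left h
  all-tabulate⁻ p f h (suc v) = all-tabulate⁻ p (f ∘ suc) (∧-right {p (f zero)} h) v

  all-tabulate⁺ : ∀ {X : Set} {n} (p : X → Bool) (f : Fin n → X) → (∀ v → p (f v) ≡ true) → all p (tabulate f) ≡ true
  all-tabulate⁺ {n = zero}  p f h = refl
  all-tabulate⁺ {n = suc n} p f h = ∧-intro (h zero) (all-tabulate⁺ p (f ∘ suc) (h ∘ suc))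

  isIClique⇒spans : ∀ i G S → isICliqueᵇ i G S ≡ true → SpansClique (adj G) everything i S
  isIClique⇒spans i G S h = spans (λ _ _ → refl) complete′ card≡
    where
    complete′ : Complete (adj G) (lookup S)
    complete′ u v u∈ v∈ ne with all-tabulate⁻ _ id (all-tabulate⁻ _ id (∧-left h) u) v
    ... | q rewrite u∈ | v∈ with u Data.Fin.≟ v
    ...   | yes u≡v = contradiction u≡v ne
    ...   | no _    = q
    card≡ : card S ≡ i
    card≡ = ≡ᵇ⇒≡ (card S) i (subst T (sym (∧-right {isCliqueᵇ G S} h)) tt)

  spans⇒isIClique : ∀ i G S → SpansClique (adj G) everything i S → isICliqueᵇ i G S ≡ true
  spans⇒isIClique i G S (spans _ com refl) = ∧-intro
    (all-tabulate⁺ _ id (λ u → all-tabulate⁺ _ id (pointwise u)))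
    (dec-true (card S Data.Nat.≟ card S) refl)
    where
    pointwise : ∀ u v → not (lookup S u ∧ lookup S v) ∨ does (u Data.Fin.≟ v) ∨ adj G u v ≡ true
    pointwise u v with lookup S u in u∈ | lookup S v in v∈
    ... | false | _     = refl
    ... | true  | false = refl
    ... | true  | true with u Data.Fin.≟ v
    ...   | yes _ = refl
    ...   | no ne = com u v u∈ v∈ ne

  ≡-from-⇔ : ∀ {a b} → (a ≡ true → b ≡ true) → (b ≡ true → a ≡ true) → a ≡ b
  ≡-from-⇔ {true}  {b}     f g = sym (f refl)
  ≡-from-⇔ {false} {true}  f g = g refl
  ≡-from-⇔ {false} {false} f g = refl

  c≡cliques : ∀ i G → c i G ≡ cliques i (adj G) everything
  c≡cliques i G = trans
    (count-cong (λ S → ≡-from-⇔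
      (λ h → spans⇒cliqueIn (adj G) everything i S (isIClique⇒spans i G S h))
      (λ h → spans⇒isIClique i G S (cliqueIn⇒spans (adj G) (Graph.sym G) everything i S h))) (subsets (n G)))
    (count-cliqueIn i (adj G) everything)

  !*c≡t : ∀ i G → i ! * c i G ≡ Tuples.t (adj G) i everything
  !*c≡t i G = trans (cong (i ! *_) (c≡cliques i G)) (!*cliques≡t i (adj G) (Graph.sym G) (irrfl G) everything)

  size-lookup : ∀ {n} (S : Vec Bool n) → size (lookup S) ≡ card S
  size-lookup [] = refl
  size-lookup (true ∷ S) = cong suc (size-lookup S)
  size-lookup (false ∷ S) = size-lookup S

  -- The upper bound for CON

  open SpansClique

  argmax : ∀ {n} (P : Mask n) (f : Fin n → ℕ) →
    (∀ v → P v ≡ false) ⊎ (∃ λ v → P v ≡ true × (∀ w → P w ≡ true → f w ≤ f v))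
  argmax {zero} P f = inj₁ λ ()
  argmax {suc n} P f with argmax (P ∘ suc) (f ∘ suc) | P zero in P₀
  ... | inj₁ none | false = inj₁ λ { zero → P₀ ; (suc v) → none v }
  ... | inj₁ none | true  = inj₂ (zero , P₀ , λ { zero _ → ≤-refl ; (suc w) w∈ → contradiction (trans (sym w∈) (none w)) λ () })
  ... | inj₂ (v , v∈ , max) | false = inj₂ (suc v , v∈ , λ { zero z∈ → contradiction (trans (sym z∈) P₀) λ () ; (suc w) w∈ → max w w∈ })
  ... | inj₂ (v , v∈ , max) | true with f zero ≤? f (suc v)
  ...   | yes le = inj₂ (suc v , v∈ , λ { zero _ → le ; (suc w) w∈ → max w w∈ })
  ...   | no gt  = inj₂ (zero , P₀ , λ { zero _ → ≤-refl ; (suc w) w∈ → ≤-trans (max w w∈) (≰⇒≥ gt) })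

  singleton : ∀ {n} → Fin n → Mask n
  singleton v u = does (u Data.Fin.≟ v)

  singleton-self : ∀ {n} (v : Fin n) → singleton v v ≡ true
  singleton-self v = dec-true (v Data.Fin.≟ v) refl

  singleton-≢ : ∀ {n} {u v : Fin n} → u ≢ v → singleton v u ≡ false
  singleton-≢ {u = u} {v} = dec-false (u Data.Fin.≟ v)

  size-singleton : ∀ {n} (v : Fin n) → size (singleton v) ≡ 1
  size-singleton v = trans
    (sum-supported (λ u → ⟦ singleton v u ⟧ 1) v (λ u u≢v → cong (⟦_⟧ 1) (singleton-≢ u≢v)))
    (cong (⟦_⟧ 1) (singleton-self v))

  module UpperBound (o : ℕ) (G : Graph) (N b r : ℕ) (b<N : b < N) (r< : r < b C o)
    (count≡ : c (suc (suc o)) G ≡ N C suc (suc o) + b C suc o + r) (clique : HasClique N G) where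

    p k R : ℕ
    p = suc o
    k = suc p
    R = p ! * r

    E = adj G
    E-sym = Graph.sym G
    E-irr = irrfl G
    open Tuples E

    K : Mask (n G)
    K = lookup (proj₁ clique)

    spansK : SpansClique E everything N (proj₁ clique)
    spansK = isIClique⇒spans N G (proj₁ clique) (proj₂ clique)

    sizeK : size K ≡ N
    sizeK = trans (size-lookup (proj₁ clique)) (has-card spansK)

    tK : ∀ i → t i K ≡ F i N
    tK i = trans (t-complete E E-irr i K (complete spansK)) (cong (F i) sizeK)

    deg : Fin (n G) → ℕ
    deg w = size (K ∩ E w)

    t-deg : ∀ i w → t i (K ∩ E w) ≡ F i (deg w)
    t-deg i w = t-complete E E-irr i (K ∩ E w) (λ u v u∈ v∈ → complete spansK u v (∧-left u∈) (∧-left v∈))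

    tU : t k everything ≡ F k N + k * (F p b + R)
    tU = begin
      t k everything                               ≡⟨ !*c≡t k G ⟨
      k ! * c k G                                  ≡⟨ cong (k ! *_) count≡ ⟩
      k ! * (N C k + b C p + r)                    ≡⟨ ring k (p !) (N C k) (b C p) r ⟩
      k ! * (N C k) + k * (p ! * (b C p) + R)      ≡⟨ cong₂ (λ x y → x + k * (y + R)) (!*C≡F k N) (!*C≡F p b) ⟩
      F k N + k * (F p b + R)                      ∎
      where
      open ≡-Reasoning
      ring : ∀ k f x y r → k * f * (x + y + r) ≡ k * f * x + k * (f * y + f * r)
      ring = solve-∀

    R< : R < p * F o b
    R< = begin-strict
      p ! * r                 <⟨ *-monoʳ-< (p !) {{p !≢0}} r< ⟩
      p ! * (b C o)           ≡⟨ *-assoc p (o !) (b C o) ⟩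
      p * (o ! * (b C o))     ≡⟨ cong (p *_) (!*C≡F o b) ⟩
      p * F o b               ∎
      where open ≤-Reasoning

    -- This makes `b` the largest possible degree into `K`: a vertex outside `K` with more than `b`
    -- neighbours in it would alone produce too many k-cliques.
    Fb+R< : F p b + R < F p (suc b)
    Fb+R< = <-≤-trans (+-monoʳ-< (F p b) R<) (≤-reflexive (sym (F-pascal o b)))

    unscale : ∀ ℓ → t (suc k) everything ≤ F (suc k) N + suc k * (F k b + ℓ * R) →
      c (suc k) G ≤ N C suc k + b C k + ℓ * r
    unscale ℓ h = *-cancelˡ-≤ (suc k !) {{suc k !≢0}} (begin
      suc k ! * c (suc k) G                               ≡⟨ !*c≡t (suc k) G ⟩
      t (suc k) everything                                ≤⟨ h ⟩
      F (suc k) N + suc k * (F k b + ℓ * R)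
        ≡⟨ cong₂ (λ x y → x + suc k * (y + ℓ * R)) (!*C≡F (suc k) N) (!*C≡F k b) ⟨
      suc k ! * (N C suc k) + suc k * (k ! * (b C k) + ℓ * (p ! * r))
        -- Only the error term is rounded up, from `p !` to `k !`, so that `suc k !` factors out;
        -- the main terms stay exact.
        ≤⟨ +-monoʳ-≤ (suc k ! * (N C suc k)) (*-monoʳ-≤ (suc k) (+-monoʳ-≤ (k ! * (b C k))
             (*-monoʳ-≤ ℓ (*-monoˡ-≤ r (m≤n*m (p !) k))))) ⟩
      suc k ! * (N C suc k) + suc k * (k ! * (b C k) + ℓ * (k ! * r))
        ≡⟨ ring (suc k) (k !) (N C suc k) (b C k) ℓ r ⟩
      suc k ! * (N C suc k + b C k + ℓ * r)               ∎)
      where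
      open ≤-Reasoning
      ring : ∀ s f x y ℓ r → s * f * x + s * (f * y + ℓ * (f * r)) ≡ s * f * (x + y + ℓ * r)
      ring = solve-∀

    upper-if-no-outside : (∀ v → not (K v) ≡ false) → t (suc k) everything ≤ F (suc k) N
    upper-if-no-outside none = begin
      t (suc k) everything
        ≤⟨ t-upper k everything ⟩
      t (suc k) K + suc k * sum (λ w → ⟦ not (K w) ⟧ t k (E w))
        ≡⟨ cong₂ (λ x y → x + suc k * y) (tK (suc k))
             (trans (sum-cong-≗ (λ w → cong (⟦_⟧ t k (E w)) (none w))) (sum-replicate-zero (n G))) ⟩
      F (suc k) N + suc k * 0
        ≡⟨ trans (cong (F (suc k) N +_) (*-zeroʳ (suc k))) (+-identityʳ _) ⟩
      F (suc k) N ∎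
      where
      open ≤-Reasoning
      open Relative E-sym K

    module Outside (v₁ : Fin (n G)) (v₁∉K : not (K v₁) ≡ true) (v₁-max : ∀ w → not (K w) ≡ true → deg w ≤ deg v₁) where

      d : ℕ
      d = deg v₁

      W : Mask (n G)
      W v = K v ∨ singleton v₁ v

      K⊆W : K ⊆ W
      K⊆W v v∈ rewrite v∈ = refl

      v₁∈ : (W ∖ K) v₁ ≡ true
      v₁∈ = ∧-intro (trans (cong (K v₁ ∨_) (singleton-self v₁)) (∨-zeroʳ (K v₁))) v₁∉K

      W∖K-off : ∀ w → w ≢ v₁ → (W ∖ K) w ≡ false
      W∖K-off w w≢v₁ with K w
      ... | true  = refl
      ... | false rewrite singleton-≢ w≢v₁ = refl

      -- With `K` as the reference set, `t-lower` and `t-upper` meet on `W`: its only vertex outside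
      -- `K` is `v₁`, which has all its neighbours in `W` inside `K`. So the tuple count of `W` is
      -- known exactly.
      tW-lower : ∀ i → F (suc i) N + suc i * F i d ≤ t (suc i) W
      tW-lower i = begin
        F (suc i) N + suc i * F i d
          ≡⟨ cong₂ (λ x y → x + suc i * y) (tK (suc i)) (t-deg i v₁) ⟨
        t (suc i) K + suc i * t i (K ∩ E v₁)
          ≤⟨ +-mono-≤ (t-mono (suc i) λ v v∈ → ∧-intro (K⊆W v v∈) v∈) (*-monoʳ-≤ (suc i) (t-mono i λ v v∈ →
               ∧-intro (∧-intro (K⊆W v (∧-left v∈)) (∧-right {K v} v∈)) (∧-left v∈))) ⟩
        t (suc i) (W ∩ K) + suc i * t i (W ∩ E v₁ ∩ K)
          ≡⟨ cong (λ z → t (suc i) (W ∩ K) + suc i * ⟦ z ⟧ t i (W ∩ E v₁ ∩ K)) v₁∈ ⟨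
        t (suc i) (W ∩ K) + suc i * ⟦ (W ∖ K) v₁ ⟧ t i (W ∩ E v₁ ∩ K)
          ≤⟨ +-monoʳ-≤ (t (suc i) (W ∩ K)) (*-monoʳ-≤ (suc i) (term≤sum (λ w → ⟦ (W ∖ K) w ⟧ t i (W ∩ E w ∩ K)) v₁)) ⟩
        t (suc i) (W ∩ K) + suc i * sum (λ w → ⟦ (W ∖ K) w ⟧ t i (W ∩ E w ∩ K))
          ≤⟨ t-lower i W ⟩
        t (suc i) W ∎
        where
        open ≤-Reasoning
        open Relative E-sym K

      link-v₁ : W ∩ E v₁ ⊆ K ∩ E v₁
      link-v₁ v h with v Data.Fin.≟ v₁
      ... | yes refl = contradiction (trans (sym (∧-right {K v ∨ true} h)) (E-irr v)) λ ()
      ... | no _ with K v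
      ...   | true = h

      tW-upper : ∀ i → t (suc i) W ≤ F (suc i) N + suc i * F i d
      tW-upper i = begin
        t (suc i) W
          ≤⟨ t-upper i W ⟩
        t (suc i) (W ∩ K) + suc i * sum (λ w → ⟦ (W ∖ K) w ⟧ t i (W ∩ E w))
          ≡⟨ cong (λ z → t (suc i) (W ∩ K) + suc i * z) (sum-supported (λ w → ⟦ (W ∖ K) w ⟧ t i (W ∩ E w)) v₁
               (λ w w≢v₁ → cong (⟦_⟧ t i (W ∩ E w)) (W∖K-off w w≢v₁))) ⟩
        t (suc i) (W ∩ K) + suc i * ⟦ (W ∖ K) v₁ ⟧ t i (W ∩ E v₁)
          ≡⟨ cong (λ z → t (suc i) (W ∩ K) + suc i * ⟦ z ⟧ t i (W ∩ E v₁)) v₁∈ ⟩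
        t (suc i) (W ∩ K) + suc i * t i (W ∩ E v₁)
          ≤⟨ +-mono-≤ (t-mono (suc i) λ v v∈ → ∧-right {W v} v∈) (*-monoʳ-≤ (suc i) (t-mono i link-v₁)) ⟩
        t (suc i) K + suc i * t i (K ∩ E v₁)
          ≡⟨ cong₂ (λ x y → x + suc i * y) (tK (suc i)) (t-deg i v₁) ⟩
        F (suc i) N + suc i * F i d ∎
        where
        open ≤-Reasoning
        open Relative E-sym K

      X : ℕ
      X = t k everything ∸ t k W

      tX : t k everything ≡ t k W + X
      tX = sym (m+[n∸m]≡n (t-mono k λ _ _ → refl))

      X-bound : k * F p d + X ≤ k * (F p b + R)
      X-bound = +-cancelˡ-≤ (F k N) _ _ (begin
        F k N + (k * F p d + X)    ≡⟨ +-assoc (F k N) _ X ⟨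
        F k N + k * F p d + X      ≤⟨ +-monoˡ-≤ X (tW-lower p) ⟩
        t k W + X                  ≡⟨ trans (sym tX) tU ⟩
        F k N + k * (F p b + R)    ∎)
        where open ≤-Reasoning

      Fd≤ : F p d ≤ F p b + R
      Fd≤ = *-cancelˡ-≤ k (≤-trans (m≤m+n (k * F p d) X) X-bound)

      -- The budget of k-tuples leaving `W`, divided by the `k` positions. It measures how far `d`
      -- lies below `b`, up to `R`.
      Z : ℕ
      Z = (F p b + R) ∸ F p d

      Z-def : F p d + Z ≡ F p b + R
      Z-def = m+[n∸m]≡n Fd≤

      X≤kZ : X ≤ k * Z
      X≤kZ = +-cancelˡ-≤ (k * F p d) X (k * Z) (≤-trans X-bound
        (≤-reflexive (trans (cong (k *_) (sym Z-def)) (*-distribˡ-+ k (F p d) Z))))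

      d≤b : d ≤ b
      d≤b = ≮⇒≥ λ b<d → <⇒≱ Fb+R< (≤-trans (F-mono p b<d) Fd≤)

      X≤ : X ≤ k * N ^ p
      X≤ = begin
        X                   ≤⟨ ≤-trans (m≤n+m X (k * F p d)) X-bound ⟩
        k * (F p b + R)     ≤⟨ *-monoʳ-≤ k (<⇒≤ Fb+R<) ⟩
        k * F p (suc b)     ≤⟨ *-monoʳ-≤ k (≤-trans (F≤^ p (suc b)) (^-monoˡ-≤ p b<N)) ⟩
        k * N ^ p           ∎
        where open ≤-Reasoning

      outside-W⇒outside-K : ∀ w → not (W w) ≡ true → not (K w) ≡ true
      outside-W⇒outside-K w h with K w
      ... | false = refl

      -- The extra 1 accounts for `v₁`.
      link-size : ∀ w → size (E w ∩ W) ≤ suc (deg w)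
      link-size w = begin
        size (E w ∩ W)                                               ≤⟨ sum-mono pointwise ⟩
        sum (λ u → ⟦ singleton v₁ u ⟧ 1 + ⟦ (K ∩ E w) u ⟧ 1)        ≡⟨ ∑-distrib-+ (λ u → ⟦ singleton v₁ u ⟧ 1) (λ u → ⟦ (K ∩ E w) u ⟧ 1) ⟩
        size (singleton v₁) + deg w                                  ≡⟨ cong (_+ deg w) (size-singleton v₁) ⟩
        suc (deg w)                                                  ∎
        where
        open ≤-Reasoning
        pointwise : ∀ u → ⟦ (E w ∩ W) u ⟧ 1 ≤ ⟦ singleton v₁ u ⟧ 1 + ⟦ (K ∩ E w) u ⟧ 1
        pointwise u with E w u | K u | singleton v₁ u
        ... | false | _     | _     = z≤n
        ... | true  | true  | true  = s≤s z≤n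
        ... | true  | true  | false = ≤-refl
        ... | true  | false | true  = ≤-refl
        ... | true  | false | false = z≤n

      -- Any `p` neighbours of `w` in `K` form with `w` a k-clique leaving `W`, so a small budget
      -- `Z` forces a small degree.
      F-deg≤Z : ∀ w → not (W w) ≡ true → F p (deg w) ≤ Z
      F-deg≤Z w w∉ = *-cancelˡ-≤ k (begin
        k * F p (deg w)                                         ≡⟨ cong (k *_) (t-deg p w) ⟨
        k * t p (K ∩ E w)                                       ≤⟨ *-monoʳ-≤ k (t-mono p λ v v∈ → ∧-intro (∧-right {K v} v∈) (K⊆W v (∧-left v∈))) ⟩
        k * t p (E w ∩ W)                                       ≡⟨ cong (λ z → k * ⟦ z ⟧ t p (E w ∩ W)) w∉ ⟨
        k * ⟦ not (W w) ⟧ t p (E w ∩ W)                         ≤⟨ *-monoʳ-≤ k (term≤sum (λ w → ⟦ not (W w) ⟧ t p (E w ∩ W)) w) ⟩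
        k * sum (λ w → ⟦ not (W w) ⟧ t p (E w ∩ W))             ≤⟨ +-cancelˡ-≤ (t k W) _ _ (≤-trans (t-lower p everything) (≤-reflexive tX)) ⟩
        X                                                       ≤⟨ X≤kZ ⟩
        k * Z                                                   ∎)
        where
        open ≤-Reasoning
        open Relative E-sym W

      module _ (D : ℕ) .{{_ : NonZero D}} (M : ℕ) (hM : k * N ^ p ≤ M * D ^ p) where

        Λ : ℕ
        Λ = k * (p * D + M)

        leaving : ∀ L → (∀ w → not (W w) ≡ true → size (E w ∩ W) ≤ L) →
          t (suc k) everything ≤ F (suc k) N + suc k * (F k d + (Λ + L) * Z)
        leaving L hL = begin
          t (suc k) everything                                      ≤⟨ *-cancelˡ-≤ k scaled ⟩
          t (suc k) W + suc k * ((Λ + L) * Z)                       ≤⟨ +-monoˡ-≤ _ (tW-upper k) ⟩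
          F (suc k) N + suc k * F k d + suc k * ((Λ + L) * Z)       ≡⟨ ring₂ (F (suc k) N) (suc k) (F k d) ((Λ + L) * Z) ⟩
          F (suc k) N + suc k * (F k d + (Λ + L) * Z)               ∎
          where
          open ≤-Reasoning
          open Relative E-sym W
          ring₁ : ∀ k x s ℓ z → k * x + s * (ℓ * (k * z)) ≡ k * (x + s * (ℓ * z))
          ring₁ = solve-∀
          ring₂ : ∀ f s x y → f + s * x + s * y ≡ f + s * (x + y)
          ring₂ = solve-∀
          scaled : k * t (suc k) everything ≤ k * (t (suc k) W + suc k * ((Λ + L) * Z))
          scaled = begin
            k * t (suc k) everything
              ≤⟨ t-leaving-bound o D everything X M L tX (≤-trans X≤ hM) hL ⟩
            k * t (suc k) W + suc k * ((Λ + L) * X)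
              -- The factor `k` saved in `t-leaving-bound` pays for the one in `X ≤ k * Z`; the
              -- coefficient of `Z` is therefore exactly `Λ + L`, which both exchange inequalities
              -- rely on.
              ≤⟨ +-monoʳ-≤ (k * t (suc k) W) (*-monoʳ-≤ (suc k) (*-monoʳ-≤ (Λ + L) X≤kZ)) ⟩
            k * t (suc k) W + suc k * ((Λ + L) * (k * Z))
              ≡⟨ ring₁ k (t (suc k) W) (suc k) (Λ + L) Z ⟩
            k * (t (suc k) W + suc k * ((Λ + L) * Z)) ∎

        -- If d is far below b the trivial bound |N(w) ∩ W| ≤ d + 1 suffices; if d is close to b,
        -- few cliques leave W and so every w ∉ W has few neighbours in K.
        upper-if-outside : ∀ L → p + (Λ + L) ≤ b → suc (Λ + (p + p)) * (p * N ^ o) < F p L →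
          t (suc k) everything ≤ F (suc k) N + suc k * (F k b + (Λ + L) * R)
        upper-if-outside L hb hL with (Λ + suc d) + (p + p) ≤? b
        ... | yes far = ≤-trans
          (leaving (suc d) (λ w w∉ → ≤-trans (link-size w) (s≤s (v₁-max w (outside-W⇒outside-K w w∉)))))
          (+-monoʳ-≤ (F (suc k) N) (*-monoʳ-≤ (suc k) (≤-trans
            (exchange-far o d b (Λ + suc d) Z R (≤-trans (n≤1+n d) (m≤n+m (suc d) Λ)) far (≤-reflexive Z-def) (<⇒≤ R<))
            (m≤m+n (F k b) _))))
        ... | no near = ≤-trans
          (leaving L (λ w w∉ → ≤-trans (link-size w) (deg<L w w∉)))
          (+-monoʳ-≤ (F (suc k) N) (*-monoʳ-≤ (suc k)
            (exchange-near p d b (Λ + L) Z R d≤b hb (≤-reflexive Z-def))))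
          where
          e = b ∸ d
          b≡ : d + e ≡ b
          b≡ = m+[n∸m]≡n d≤b
          ring : ∀ Λ d q → Λ + suc d + q ≡ suc (d + (Λ + q))
          ring = solve-∀
          e≤ : e ≤ Λ + (p + p)
          e≤ = ≤-trans (∸-monoˡ-≤ d (≤-pred (≤-trans (≰⇒> near) (≤-reflexive (ring Λ d (p + p))))))
            (≤-reflexive (m+n∸m≡n d _))
          -- Here `e` of the multiples of `p * F o b` come from F p b - F p d, and one more comes
          -- from `R`.
          Z≤ : Z ≤ suc (Λ + (p + p)) * (p * N ^ o)
          Z≤ = +-cancelˡ-≤ (F p d) _ _ (begin
            F p d + Z                                              ≡⟨ Z-def ⟩
            F p b + R                                              ≤⟨ +-mono-≤ Fb≤ (<⇒≤ R<) ⟩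
            F p d + e * (p * F o b) + p * F o b                    ≡⟨ +-assoc (F p d) _ _ ⟩
            F p d + (e * (p * F o b) + p * F o b)                  ≡⟨ cong (F p d +_) (+-comm (e * (p * F o b)) _) ⟩
            F p d + suc e * (p * F o b)                            ≤⟨ +-monoʳ-≤ (F p d) (*-mono-≤ (s≤s e≤) (*-monoʳ-≤ p Fo≤)) ⟩
            F p d + suc (Λ + (p + p)) * (p * N ^ o)                ∎)
            where
            open ≤-Reasoning
            Fb≤ : F p b ≤ F p d + e * (p * F o b)
            Fb≤ = subst (λ z → F p z ≤ F p d + e * (p * F o z)) b≡ (F-increment o d e)
            Fo≤ : F o b ≤ N ^ o
            Fo≤ = ≤-trans (F≤^ o b) (^-monoˡ-≤ o (<⇒≤ b<N))
          deg<L : ∀ w → not (W w) ≡ true → deg w < L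
          deg<L w w∉ = ≰⇒> λ L≤ → <⇒≱ hL (≤-trans (F-mono p L≤) (≤-trans (F-deg≤Z w w∉) Z≤))

    upper-bound : ∀ D .{{_ : NonZero D}} M L → k * N ^ p ≤ M * D ^ p →
      p + (k * (p * D + M) + L) ≤ b → suc (k * (p * D + M) + (p + p)) * (p * N ^ o) < F p L →
      c (suc k) G ≤ N C suc k + b C k + (k * (p * D + M) + L) * r
    upper-bound D M L hM hb hL with argmax (not ∘ K) deg
    ... | inj₁ none = unscale (k * (p * D + M) + L) (≤-trans (upper-if-no-outside none) (m≤m+n _ _))
    ... | inj₂ (v₁ , v₁∉K , v₁-max) = unscale (k * (p * D + M) + L) (Outside.upper-if-outside v₁ v₁∉K v₁-max D M hM L hb hL)

  -- The lower bound for CON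

  emptyGraph : Graph
  emptyGraph = record { n = 0 ; adj = λ () ; sym = λ () ; irrfl = λ () }

  attach : (G : Graph) → Mask (n G) → Graph
  attach G B = record { n = suc (n G) ; adj = E ; sym = E-sym ; irrfl = E-irr }
    where
    E : Relation (suc (n G))
    E zero    zero    = false
    E zero    (suc v) = B v
    E (suc u) zero    = B u
    E (suc u) (suc v) = adj G u v
    E-sym : ∀ u v → E u v ≡ E v u
    E-sym zero    zero    = refl
    E-sym zero    (suc v) = refl
    E-sym (suc u) zero    = refl
    E-sym (suc u) (suc v) = Graph.sym G u v
    E-irr : ∀ u → E u u ≡ false
    E-irr zero    = refl
    E-irr (suc u) = irrfl G u

  -- The b oldest vertices of a graph grown by attach, which adds the new vertex at index zero.
  oldest : ∀ n → ℕ → Mask n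
  oldest (suc n) b zero    = suc n ≤ᵇ b
  oldest (suc n) b (suc v) = oldest n b v

  oldest-all : ∀ n b → n ≤ b → ∀ v → oldest n b v ≡ true
  oldest-all (suc n) b n<b zero    = dec-true (suc n ≤? b) n<b
  oldest-all (suc n) b n<b (suc v) = oldest-all n b (<⇒≤ n<b) v

  cliques-oldest-attach : ∀ i G B b → b ≤ n G →
    cliques i (adj (attach G B)) (oldest (suc (n G)) b) ≡ cliques i (adj G) (oldest (n G) b)
  cliques-oldest-attach zero    G B b b≤n = refl
  cliques-oldest-attach (suc i) G B b b≤n rewrite dec-false (suc (n G) ≤? b) (≤⇒≯ b≤n) = refl

  -- The `N` oldest vertices form a clique, stated through the counts that are used later. As
  -- `attach` puts the new vertex at index `zero`, the counts survive every attachment.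
  record HasCore (N : ℕ) (G : Graph) : Set where
    constructor core
    field
      enough      : N ≤ n G
      core-counts : ∀ b i → b ≤ N → cliques i (adj G) (oldest (n G) b) ≡ b C i
  open HasCore

  attach-core : ∀ {N G} B → HasCore N G → HasCore N (attach G B)
  attach-core {G = G} B (core N≤n counts) = core (m≤n⇒m≤1+n N≤n)
    λ b i b≤N → trans (cliques-oldest-attach i G B b (≤-trans b≤N N≤n)) (counts b i b≤N)

  completeGraph : ℕ → Graph
  completeGraph zero    = emptyGraph
  completeGraph (suc N) = attach (completeGraph N) everything

  n-completeGraph : ∀ N → n (completeGraph N) ≡ N
  n-completeGraph zero    = refl
  n-completeGraph (suc N) = cong suc (n-completeGraph N)

  cliques-completeGraph : ∀ i N → cliques i (adj (completeGraph N)) everything ≡ N C i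
  cliques-completeGraph zero    N       = refl
  cliques-completeGraph (suc i) zero    = sym (k>n⇒nCk≡0 {0} {suc i} (s≤s z≤n))
  cliques-completeGraph (suc i) (suc N) = trans
    (cong₂ _+_ (cliques-completeGraph i N) (cliques-completeGraph (suc i) N))
    (nCk+nC[k+1]≡[n+1]C[k+1] N i)

  completeGraph-core : ∀ N → HasCore N (completeGraph N)
  completeGraph-core N = core (≤-reflexive (sym (n-completeGraph N))) (counts N)
    where
    counts : ∀ N b i → b ≤ N → cliques i (adj (completeGraph N)) (oldest (n (completeGraph N)) b) ≡ b C i
    counts N b i b≤N with m≤n⇒m<n∨m≡n b≤N
    ... | inj₂ refl = trans (cliques-cong i (adj (completeGraph N)) (oldest-all _ N (≤-reflexive (n-completeGraph N))))
      (cliques-completeGraph i N)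
    counts (suc N) b i _ | inj₁ (s≤s b≤N) = trans
      (cliques-oldest-attach i (completeGraph N) everything b (≤-trans b≤N (≤-reflexive (sym (n-completeGraph N)))))
      (counts N b i b≤N)

  attachMany : ℕ → ℕ → Graph → Graph
  attachMany zero    b G = G
  attachMany (suc r) b G = attach (attachMany r b G) (oldest _ b)

  attachMany-core : ∀ {N G} r b → HasCore N G → HasCore N (attachMany r b G)
  attachMany-core zero    b h = h
  attachMany-core (suc r) b h = attach-core _ (attachMany-core r b h)

  -- All new vertices are joined to the same `b` core vertices and not to each other, so their
  -- contributions simply add up.
  cliques-attachMany : ∀ {N G} r b i → HasCore N G → b ≤ N →
    cliques (suc i) (adj (attachMany r b G)) everything ≡ r * (b C i) + cliques (suc i) (adj G) everything
  cliques-attachMany zero    b i h b≤N = refl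
  cliques-attachMany (suc r) b i h b≤N = trans
    (cong₂ _+_ (core-counts (attachMany-core r b h) b i b≤N) (cliques-attachMany r b i h b≤N))
    (sym (+-assoc (b C i) (r * (b C i)) _))

  count-positive : ∀ {X : Set} (p : X → Bool) xs → 0 < count p xs → ∃ λ x → p x ≡ true
  count-positive p (x ∷ xs) h with p x in eq
  ... | true  = x , eq
  ... | false = count-positive p xs h

  extremal : ∀ o N b r → b < N → suc o ≤ N → let k = suc (suc o) in
    ∃ λ G → c k G ≡ N C k + b C suc o + r × HasClique N G × c (suc k) G ≡ N C suc k + b C k
  extremal o N@(suc N₀) b r b<N p≤N = G , count-k , clique , count-suc-k
    where
    k = suc (suc o)
    G₁ = attachMany 1 b (completeGraph N)
    G = attachMany r (suc o) G₁
    counts : ∀ i → c (suc i) G ≡ r * (suc o C i) + (b C i + N C suc i)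
    counts i = trans (c≡cliques (suc i) G)
      (trans (cliques-attachMany r (suc o) i (attachMany-core 1 b (completeGraph-core N)) p≤N)
        (cong (r * (suc o C i) +_) (trans (cliques-attachMany 1 b i (completeGraph-core N) (<⇒≤ b<N))
          (cong₂ _+_ (+-identityʳ (b C i)) (cliques-completeGraph (suc i) N)))))
    ring : ∀ r b x → r * 1 + (b + x) ≡ x + b + r
    ring = solve-∀
    -- Each of the `r` last vertices has just `suc o` neighbours, all in the core: it closes one
    -- k-clique and no (k+1)-clique.
    count-k : c k G ≡ N C k + b C suc o + r
    count-k = trans (counts (suc o)) (trans (cong (λ z → r * z + (b C suc o + N C k)) (nCn≡1 (suc o)))
      (ring r (b C suc o) (N C k)))
    count-suc-k : c (suc k) G ≡ N C suc k + b C k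
    count-suc-k = trans (counts k) (trans (cong (λ z → r * z + (b C k + N C suc k)) (k>n⇒nCk≡0 {suc o} {k} ≤-refl))
      (trans (cong (_+ (b C k + N C suc k)) (*-zeroʳ r)) (+-comm (b C k) _)))
    clique : HasClique N G
    -- The required clique is obtained from counting: the term N C N = 1 makes `c N G` positive.
    clique = count-positive (isICliqueᵇ N G) (subsets (n G)) (begin-strict
      0                                              <⟨ s≤s z≤n ⟩
      1                                              ≡⟨ nCn≡1 N ⟨
      N C N                                          ≤⟨ m≤n+m _ _ ⟩
      b C N₀ + N C N                                 ≤⟨ m≤n+m _ (r * (suc o C N₀)) ⟩
      r * (suc o C N₀) + (b C N₀ + N C N)            ≡⟨ counts N₀ ⟨
      c N G                                          ∎)
      where open ≤-Reasoning

  -- The two representations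

  C-positive : ∀ {i x} → i ≤ x → 1 ≤ x C i
  C-positive {i} i≤x = ≤-trans (≤-reflexive (sym (nCn≡1 i))) (C-mono i i≤x)

  C-suc≤ : ∀ x i → x C suc i ≤ x * (x C i)
  C-suc≤ x i = *-cancelˡ-≤ (i !) {{i !≢0}} (begin
    i ! * (x C suc i)             ≤⟨ *-monoˡ-≤ (x C suc i) (m≤n*m (i !) (suc i)) ⟩
    suc i ! * (x C suc i)         ≡⟨ !*C≡F (suc i) x ⟩
    F (suc i) x                   ≤⟨ m≤m+n _ (i * F i x) ⟩
    F (suc i) x + i * F i x       ≡⟨ F-step i x ⟩
    x * F i x                     ≡⟨ cong (x *_) (!*C≡F i x) ⟨
    x * (i ! * (x C i))           ≡⟨ ring x (i !) (x C i) ⟩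
    i ! * (x * (x C i))           ∎)
    where
    open ≤-Reasoning
    ring : ∀ x f y → x * (f * y) ≡ f * (x * y)
    ring = solve-∀

  -- The greedy property of cascades: by induction the tail stays below C(b + 1, r - 1), hence below
  -- C(a, r - 1), and Pascal's rule closes the gap.
  rep-bound : ∀ r a l → length (a ∷ l) ≤ r → Decr (a ∷ l) → LastGe r (a ∷ l) → r ≤ a × repSum 0 r (a ∷ l) < suc a C r
  rep-bound (suc r) a [] _ _ r<a rewrite +-identityʳ r | +-identityʳ (a C suc r) =
    r<a , ≤-trans (+-monoˡ-≤ (a C suc r) (C-positive (<⇒≤ r<a))) (≤-reflexive (nCk+nC[k+1]≡[n+1]C[k+1] a r))
  rep-bound (suc r) a (b ∷ l) (s≤s len) (a>b ∷ dec) last with rep-bound r b l len dec last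
  ... | r≤b , tail< = ≤-trans (s≤s r≤b) a>b , (begin-strict
    a C (suc r + 0) + repSum 0 r (b ∷ l)   ≡⟨ cong (λ z → a C z + repSum 0 r (b ∷ l)) (+-identityʳ (suc r)) ⟩
    a C suc r + repSum 0 r (b ∷ l)   <⟨ +-monoʳ-< (a C suc r) (<-≤-trans tail< (C-mono r a>b)) ⟩
    a C suc r + a C r                ≡⟨ trans (+-comm (a C suc r) _) (nCk+nC[k+1]≡[n+1]C[k+1] a r) ⟩
    suc a C suc r                    ∎)
    where open ≤-Reasoning

  -- Termwise: raising the lower index of C(x, i) by one costs at most a factor x, and the head is
  -- the largest entry.
  rep-ratio : ∀ r A a l → Decr (a ∷ l) → a ≤ A → repSum 1 r (a ∷ l) ≤ A * repSum 0 r (a ∷ l)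
  rep-ratio r A a l dec a≤A = ≤-trans (+-mono-≤ term (tail l dec)) (≤-reflexive (sym (*-distribˡ-+ A (a C (r + 0)) (repSum 0 (r ∸ 1) l))))
    where
    term : a C (r + 1) ≤ A * (a C (r + 0))
    term rewrite +-comm r 1 | +-identityʳ r = ≤-trans (C-suc≤ a r) (*-monoˡ-≤ (a C r) a≤A)
    tail : ∀ l → Decr (a ∷ l) → repSum 1 (r ∸ 1) l ≤ A * repSum 0 (r ∸ 1) l
    tail [] _ = z≤n
    tail (b ∷ l) (a>b ∷ dec) = rep-ratio (r ∸ 1) A b l dec (≤-trans (<⇒≤ a>b) a≤A)

  leading-unique : ∀ i {n n′ m} → n C i ≤ m → m < suc n C i → n′ C i ≤ m → m < suc n′ C i → n ≡ n′
  leading-unique i lo hi lo′ hi′ = ≤-antisym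
    (≮⇒≥ λ n′<n → <⇒≱ hi′ (≤-trans (C-mono i n′<n) lo))
    (≮⇒≥ λ n<n′ → <⇒≱ hi (≤-trans (C-mono i n<n′) lo′))

  -- The data shared by both representations: r is what remains of m after the two leading terms.
  record Leading (o m N b r : ℕ) : Set where
    constructor leading
    field
      b<N : b < N
      r<  : r < b C o
      m≡  : m ≡ N C suc (suc o) + b C suc o + r

  leading-< : ∀ {o m N b r} → Leading o m N b r → m < suc N C suc (suc o)
  leading-< {o} {m} {N} {b} {r} (leading b<N r< refl) = begin-strict
    N C k + b C p + r         ≡⟨ +-assoc (N C k) _ r ⟩
    N C k + (b C p + r)       <⟨ +-monoʳ-< (N C k) (+-monoʳ-< (b C p) r<) ⟩
    N C k + (b C p + b C o)   ≡⟨ cong (N C k +_) (trans (+-comm (b C p) _) (nCk+nC[k+1]≡[n+1]C[k+1] b o)) ⟩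
    N C k + suc b C p         ≤⟨ +-monoʳ-≤ (N C k) (C-mono p b<N) ⟩
    N C k + N C p             ≡⟨ trans (+-comm (N C k) _) (nCk+nC[k+1]≡[n+1]C[k+1] N p) ⟩
    suc N C k                 ∎
    where
    open ≤-Reasoning
    p = suc o
    k = suc p

  leading-≥ : ∀ {o m N b r} → Leading o m N b r → N C suc (suc o) ≤ m
  leading-≥ {o} {N = N} {b} {r} (leading _ _ refl) = ≤-trans (m≤m+n _ _) (≤-reflexive (sym (+-assoc (N C suc (suc o)) (b C suc o) r)))

  -- The witnesses of `IsKK`, `IsLG` and `IsCON` each carry a representation of their own; this is
  -- what lets them be compared. The entry `b` is recovered like `N`, one index lower.
  Leading-unique : ∀ {o m N b r N′ b′ r′} → Leading o m N b r → Leading o m N′ b′ r′ → N ≡ N′ × b ≡ b′ × r ≡ r′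
  Leading-unique {o} {m} {N} {b} {r} {N′} {b′} {r′} H H′
    with leading-unique (suc (suc o)) {N} {N′} (leading-≥ H) (leading-< H) (leading-≥ H′) (leading-< H′)
  ... | refl = refl , second (Leading.r< H) (Leading.r< H′) rest≡
    where
    p = suc o
    rest≡ : b C p + r ≡ b′ C p + r′
    rest≡ = +-cancelˡ-≡ (N C suc p) _ _ (trans (sym (+-assoc (N C suc p) _ r))
      (trans (sym (Leading.m≡ H)) (trans (Leading.m≡ H′) (+-assoc (N C suc p) _ r′))))
    above : ∀ {b r} → r < b C o → b C p + r < suc b C p
    above {b} {r} r< = <-≤-trans (+-monoʳ-< (b C p) r<) (≤-reflexive (trans (+-comm (b C p) _) (nCk+nC[k+1]≡[n+1]C[k+1] b o)))
    second : r < b C o → r′ < b′ C o → b C p + r ≡ b′ C p + r′ → b ≡ b′ × r ≡ r′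
    second r< r′< eq with leading-unique p {b} {b′} (m≤m+n (b C p) r) (above {b} r<)
      (≤-trans (m≤m+n (b′ C p) r′) (≤-reflexive (sym eq))) (subst (_< suc b′ C p) (sym eq) (above {b′} r′<))
    ... | refl = refl , +-cancelˡ-≡ (b C p) r r′ eq

  secondRep-leading : ∀ o m N b as → SecondRep (suc (suc o)) m N b as → Leading o m N b (repSum 0 (suc o) as)
  secondRep-leading o m N b as (N>b , _ , _ , _ , _ , r< , m≡) = leading N>b r< m≡

  -- With Q = E L + Λ + L + 1 these are the estimates that make ρ ≤ 1/E.
  module Good (o₀ : ℕ) (N b s : ℕ) (l : List ℕ) (m kk lg con : ℕ) where
    o p k : ℕ
    o = suc o₀
    p = suc o
    k = suc p

    module _ (canon : CanonRep k m (N ∷ b ∷ s ∷ l)) (kk≡ : kk ≡ repSum 1 k (N ∷ b ∷ s ∷ l))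
             (isLG : IsLG k m lg) (isCON : IsCON k m con)
             (E D : ℕ) .{{_ : NonZero D}} (M L : ℕ) where

      Λ Q r base : ℕ
      Λ = k * (p * D + M)
      Q = E * L + (Λ + L) + 1
      r = repSum 0 o (s ∷ l)
      base = N C suc k + b C k

      s<b : s < b
      s<b = order (proj₁ (proj₂ (proj₂ canon)))
        where
        order : Decr (N ∷ b ∷ s ∷ l) → s < b
        order (_ ∷ (s<b ∷ _)) = s<b
      b<N : b < N
      b<N = order (proj₁ (proj₂ (proj₂ canon)))
        where
        order : Decr (N ∷ b ∷ s ∷ l) → b < N
        order (b<N ∷ _) = b<N
      tail-bound : o ≤ s × r < suc s C o
      tail-bound = bound canon
        where
        bound : CanonRep k m (N ∷ b ∷ s ∷ l) → o ≤ s × r < suc s C o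
        bound (_ , s≤s (s≤s len) , (_ ∷ (_ ∷ dec)) , last , _) = rep-bound o s l len dec last

      lead : Leading o m N b r
      lead = leading b<N (<-≤-trans (proj₂ tail-bound) (C-mono o s<b)) m≡
        where
        m≡ : m ≡ N C k + b C p + r
        m≡ = trans (proj₂ (proj₂ (proj₂ (proj₂ canon)))) (trans
          (cong₂ (λ x y → N C x + (b C y + r)) (+-identityʳ k) (+-identityʳ p)) (sym (+-assoc (N C k) _ r)))

      r>0 : 0 < r
      r>0 = ≤-trans (≤-trans (C-positive (proj₁ tail-bound)) (≤-reflexive (cong (s C_) (sym (+-identityʳ o))))) (m≤m+n _ _)

      CON≥ : base ≤ con
      CON≥ = bound isCON
        where
        bound : IsCON k m con → base ≤ con
        bound (N′ , (b′ , as , rep) , _ , best) with Leading-unique lead (secondRep-leading o m N′ b′ as rep)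
        ... | refl , _ with extremal o N b r b<N (≤-trans (s≤s (<⇒≤ (≤-trans (s≤s (proj₁ tail-bound)) s<b))) b<N)
        ...   | G , ck≡ , clique , csk≡ = ≤-trans (≤-reflexive (sym csk≡)) (best G (trans ck≡ (sym (Leading.m≡ lead))) clique)

      -- The third canonical term `s C p` supplies the whole gain; the later ones are dropped.
      KK≥ : Q * r ≤ s C p → base + Q * r ≤ kk
      KK≥ h = begin
        base + Q * r                                                    ≡⟨ +-assoc (N C suc k) (b C k) (Q * r) ⟩
        N C suc k + (b C k + Q * r)                                     ≤⟨ +-monoʳ-≤ (N C suc k) (+-monoʳ-≤ (b C k) (≤-trans h (m≤m+n _ (repSum 1 (o ∸ 1) l)))) ⟩
        N C suc k + (b C k + (s C p + repSum 1 (o ∸ 1) l))              ≡⟨ cong (λ z → N C suc (suc z) + (b C suc z + (s C z + repSum 1 (o ∸ 1) l))) (+-comm o 1) ⟨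
        repSum 1 k (N ∷ b ∷ s ∷ l)                                      ≡⟨ kk≡ ⟨
        kk                                                              ∎
        where open ≤-Reasoning

      module _ (hM : k * N ^ p ≤ M * D ^ p) (hL : suc (Λ + (p + p)) * (p * N ^ o) < F p L)
               (hs : 2 * p * Q + o ≤ s) where

        LG≤ : lg ≤ base + L * r
        LG≤ = bound isLG
          where
          open ≤-Reasoning
          excess : ∀ as → SecondRep k m N b as → repSum 1 p as ≤ L * repSum 0 p as
          excess [] _ = z≤n
          -- The head satisfies C(a, p) ≤ r < C(b, o), hence F p a is below p N^o up to equality. By
          -- `hL` this is less than `F p L`, so a ≤ L.
          excess (a ∷ as) (_ , _ , _ , dec , _ , r< , _) = rep-ratio p L a as dec (≮⇒≥ λ L<a → <⇒≱ hL (begin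
            F p L                                   ≤⟨ F-mono p (<⇒≤ L<a) ⟩
            F p a                                   ≡⟨ !*C≡F p a ⟨
            p ! * (a C p)                           ≤⟨ *-monoʳ-≤ (p !) (≤-trans (≤-reflexive (cong (a C_) (sym (+-identityʳ p)))) (m≤m+n _ _)) ⟩
            p ! * repSum 0 p (a ∷ as)               ≤⟨ *-monoʳ-≤ (p !) (<⇒≤ r<) ⟩
            p * o ! * (b C o)                       ≡⟨ *-assoc p (o !) (b C o) ⟩
            p * (o ! * (b C o))                     ≡⟨ cong (p *_) (!*C≡F o b) ⟩
            p * F o b                               ≤⟨ *-monoʳ-≤ p (≤-trans (F≤^ o b) (^-monoˡ-≤ o (<⇒≤ b<N))) ⟩
            p * N ^ o                               ≤⟨ m≤n*m (p * N ^ o) (suc (Λ + (p + p))) ⟩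
            suc (Λ + (p + p)) * (p * N ^ o)         ∎))
          bound : IsLG k m lg → lg ≤ base + L * r
          bound (N′ , b′ , as , rep , lg≡) with Leading-unique lead (secondRep-leading o m N′ b′ as rep)
          ... | refl , refl , r≡ = begin
            lg                                           ≡⟨ lg≡ ⟩
            N C (k + 1) + b C k + repSum 1 p as          ≡⟨ cong (λ z → N C z + b C k + repSum 1 p as) (+-comm k 1) ⟩
            base + repSum 1 p as                         ≤⟨ +-monoʳ-≤ base (excess as rep) ⟩
            base + L * repSum 0 p as                     ≡⟨ cong (λ z → base + L * z) r≡ ⟨
            base + L * r                                 ∎

        b≥ : p + (Λ + L) ≤ b
        b≥ = begin
          p + (Λ + L)                  ≤⟨ +-mono-≤ (m≤m*n p Q {{Q≢0}}) (≤-trans (≤-trans (m≤n+m (Λ + L) (E * L)) (m≤m+n _ 1)) (m≤n*m Q p)) ⟩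
          p * Q + p * Q                ≡⟨ ring p Q ⟩
          2 * p * Q                    ≤⟨ ≤-trans (m≤m+n (2 * p * Q) o) hs ⟩
          s                            ≤⟨ <⇒≤ s<b ⟩
          b                            ∎
          where
          open ≤-Reasoning
          Q≢0 : NonZero Q
          Q≢0 = >-nonZero (m≤n+m 1 (E * L + (Λ + L)))
          ring : ∀ p q → p * q + p * q ≡ 2 * p * q
          ring = solve-∀

        CON≤ : con ≤ base + (Λ + L) * r
        CON≤ = bound isCON
          where
          bound : IsCON k m con → con ≤ base + (Λ + L) * r
          bound (N′ , (b′ , as , rep) , (G , ck≡ , clique , csk≡) , _) with Leading-unique lead (secondRep-leading o m N′ b′ as rep)
          ... | refl , _ = ≤-trans (≤-reflexive (sym csk≡))
            (UpperBound.upper-bound o G N b r b<N (Leading.r< lead) (trans ck≡ (Leading.m≡ lead)) clique D M L hM b≥ hL)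

        -- The remainder has degree o in s and `s C p` has degree o + 1, so a factor of order s is
        -- available. Passing from s + 1 to s at most doubles `F o`, since s ≥ 2 o, and `hs` says
        -- that 2 p Q ≤ s - o.
        Qr≤ : Q * r ≤ s C p
        Qr≤ = *-cancelˡ-≤ (p !) {{p !≢0}} (begin
          p * o ! * (Q * r)              ≡⟨ ring₁ p (o !) Q r ⟩
          p * Q * (o ! * r)              ≤⟨ *-monoʳ-≤ (p * Q) (≤-trans (*-monoʳ-≤ (o !) (<⇒≤ (proj₂ tail-bound))) (≤-reflexive (!*C≡F o (suc s)))) ⟩
          p * Q * F o (suc s)            ≤⟨ *-monoʳ-≤ (p * Q) doubling ⟩
          p * Q * (F o s + F o s)        ≡⟨ ring₂ p Q (F o s) ⟩
          2 * p * Q * F o s              ≤⟨ *-monoˡ-≤ (F o s) (+-cancelˡ-≤ o _ _ (≤-trans (≤-reflexive (+-comm o _)) (≤-trans hs (≤-reflexive s≡)))) ⟩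
          (s ∸ o) * F o s                ≡⟨ F-s ⟨
          F p s                          ≡⟨ !*C≡F p s ⟨
          p ! * (s C p)                  ∎)
          where
          open ≤-Reasoning
          s≡ : s ≡ o + (s ∸ o)
          s≡ = sym (m+[n∸m]≡n (proj₁ tail-bound))
          ring₁ : ∀ p f q r → p * f * (q * r) ≡ p * q * (f * r)
          ring₁ = solve-∀
          ring₂ : ∀ p q f → p * q * (f + f) ≡ 2 * p * q * f
          ring₂ = solve-∀
          F-s : F p s ≡ (s ∸ o) * F o s
          F-s = subst (λ z → F p z ≡ (s ∸ o) * F o z) (sym s≡) (F-factor o (s ∸ o))
          2o≤s : o + o ≤ s
          2o≤s = ≤-trans (+-monoˡ-≤ o (begin
            o             ≤⟨ n≤1+n o ⟩
            p             ≤⟨ m≤n*m p 2 ⟩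
            2 * p         ≤⟨ m≤m*n (2 * p) Q {{>-nonZero (m≤n+m 1 (E * L + (Λ + L)))}} ⟩
            2 * p * Q     ∎)) hs
          doubling : F o (suc s) ≤ F o s + F o s
          doubling = ≤-trans (≤-reflexive (F-pascal o₀ s)) (+-monoʳ-≤ (F o s) (+-cancelʳ-≤ (o₀ * F o₀ s) _ _ (begin
            o * F o₀ s + o₀ * F o₀ s   ≡⟨ *-distribʳ-+ (F o₀ s) o o₀ ⟨
            (o + o₀) * F o₀ s          ≤⟨ *-monoˡ-≤ (F o₀ s) (≤-trans (+-monoʳ-≤ o (n≤1+n o₀)) 2o≤s) ⟩
            s * F o₀ s                 ≡⟨ F-step o₀ s ⟨
            F o s + o₀ * F o₀ s        ∎)))

        -- E (lg - con) ≤ kk - con without subtraction. The summand 1 in `Q`, together with `r>0`,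
        -- makes the first inequality strict.
        ratio-small : con < kk × E * lg + con ≤ E * con + kk
        ratio-small = con<kk , (begin
          E * lg + con                                          ≤⟨ +-mono-≤ (*-monoʳ-≤ E LG≤) CON≤ ⟩
          E * (base + L * r) + (base + (Λ + L) * r)             ≤⟨ m≤m+n _ r ⟩
          E * (base + L * r) + (base + (Λ + L) * r) + r         ≡⟨ ring E base L r (Λ + L) ⟩
          E * base + (base + Q * r)                             ≤⟨ +-mono-≤ (*-monoʳ-≤ E CON≥) (KK≥ Qr≤) ⟩
          E * con + kk                                          ∎)
          where
          open ≤-Reasoning
          ring : ∀ E B L r x → E * (B + L * r) + (B + x * r) + r ≡ E * B + (B + (E * L + x + 1) * r)
          ring = solve-∀
          con<kk : con < kk
          con<kk = begin-strict
            con                      ≤⟨ CON≤ ⟩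
            base + (Λ + L) * r       <⟨ +-monoʳ-< base (*-monoˡ-< r {{>-nonZero r>0}} (≤-trans (≤-reflexive (+-comm 1 (Λ + L))) (+-monoˡ-≤ 1 (m≤n+m (Λ + L) (E * L))))) ⟩
            base + Q * r             ≤⟨ KK≥ Qr≤ ⟩
            kk                       ∎

  -- Rational estimates, counting and the choice of parameters

  -- A positive ε is at least 1 / `suc dε`, so a bound by its denominator suffices. The inequality
  -- `con < kk` selects the branch of `ρ` that is a quotient with positive denominator, and the
  -- truncated difference `w` is an upper bound for lg - con whatever its sign.
  ρ-small : ∀ a dε .(cop : Coprime (suc a) (suc dε)) lg kk con → let ε = mkℚ +[1+ a ] dε cop in
    con < kk → suc dε * lg + con ≤ suc dε * con + kk → ¬ (ε <ℚ ρ lg kk con)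
  ρ-small a dε cop lg kk con con<kk h ε<ρ = <⇒≱ too-large (begin
    w * E                  ≤⟨ wE≤ ⟩
    suc d                  ≤⟨ m≤n*m (suc d) (suc a) ⟩
    suc a * suc d          ∎)
    where
    open ≤-Reasoning
    E = suc dε
    w = lg ∸ con
    d = kk ∸ suc con
    kk≡ : con + suc d ≡ kk
    kk≡ = trans (+-suc con d) (m+[n∸m]≡n con<kk)
    diff : (pos kk) -ℤ (pos con) ≡ +[1+ d ]
    diff = trans (ℤ.m-n≡m⊖n kk con) (trans (ℤ.⊖-≥ (<⇒≤ con<kk)) (cong pos (trans (cong (_∸ con) (sym kk≡)) (m+n∸m≡n con (suc d)))))
    value : ρ lg kk con ≡ ((pos lg) -ℤ (pos con)) /ℚ suc d
    value rewrite diff = refl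
    wE≤ : w * E ≤ suc d
    wE≤ = begin
      w * E                      ≡⟨ trans (*-comm w E) (*-distribˡ-∸ E lg con) ⟩
      E * lg ∸ E * con           ≤⟨ ∸-monoˡ-≤ (E * con) (+-cancelʳ-≤ con _ _ (begin
        E * lg + con               ≤⟨ h ⟩
        E * con + kk               ≡⟨ cong (_+_ (E * con)) (sym (trans (+-comm (suc d) con) kk≡)) ⟩
        E * con + (suc d + con)    ≡⟨ +-assoc (E * con) (suc d) con ⟨
        E * con + suc d + con      ∎)) ⟩
      E * con + suc d ∸ E * con  ≡⟨ m+n∸m≡n (E * con) (suc d) ⟩
      suc d                      ∎
    lg-con≤w : (pos lg) -ℤ (pos con) ≤ℤ pos w
    lg-con≤w rewrite ℤ.m-n≡m⊖n lg con with ≤-total con lg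
    ... | inj₁ con≤lg = ℤ.≤-reflexive (ℤ.⊖-≥ con≤lg)
    ... | inj₂ lg≤con = subst (_≤ℤ pos w) (sym (ℤ.⊖-≤ lg≤con)) ℤ.neg-≤-pos
    too-large : suc a * suc d < w * E
    too-large = ℤ.drop‿+<+ (subst₂ Data.Integer._<_ (sym (ℤ.pos-* (suc a) (suc d))) (sym (ℤ.pos-* w E))
      (ℤ.<-≤-trans
        (ℚᵘ.drop-*<* (ℚᵘ.<-respʳ-≃ (toℚᵘ-fromℚᵘ (mkℚᵘ ((pos lg) -ℤ (pos con)) d))
          (toℚᵘ-mono-< (subst (mkℚ +[1+ a ] dε cop <ℚ_) value ε<ρ))))
        (ℤ.*-monoʳ-≤-nonNeg (pos E) lg-con≤w)))

  fraction-< : ∀ a dδ .(cop : Coprime (suc a) (suc dδ)) x j → suc dδ * x < suc j → ((pos x) /ℚ suc j) <ℚ mkℚ +[1+ a ] dδ cop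
  fraction-< a dδ cop x j h = toℚᵘ-cancel-< (ℚᵘ.<-respˡ-≃ (ℚᵘ.≃-sym (toℚᵘ-fromℚᵘ (mkℚᵘ (pos x) j)))
    (*<* (subst₂ Data.Integer._<_ (ℤ.pos-* x (suc dδ)) (ℤ.pos-* (suc a) (suc j))
      (+<+ (<-≤-trans (subst (_< suc j) (*-comm (suc dδ) x) h) (m≤n*m (suc j) (suc a)))))))

  unique-length≤ : ∀ {X : Set} {xs ys : List X} → Unique xs → (∀ {x} → x ∈ xs → x ∈ ys) → length xs ≤ length ys
  unique-length≤ {xs = []} _ _ = z≤n
  unique-length≤ {xs = x ∷ xs} {ys} (x∉ ∷ uniq) sub with ∈-∃++ (sub (here refl))
  ... | us , vs , refl = begin
    suc (length xs)               ≤⟨ s≤s (unique-length≤ uniq sub′) ⟩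
    suc (length (us ++ vs))       ≡⟨ cong suc (length-++ us) ⟩
    suc (length us + length vs)   ≡⟨ +-suc (length us) (length vs) ⟨
    length us + length (x ∷ vs)   ≡⟨ length-++ us ⟨
    length (us ++ x ∷ vs)         ∎
    where
    open ≤-Reasoning
    sub′ : ∀ {y} → y ∈ xs → y ∈ us ++ vs
    sub′ y∈ with ∈-++⁻ us (sub (there y∈))
    ... | inj₁ y∈us = ∈-++⁺ˡ y∈us
    ... | inj₂ (here refl) = contradiction refl (All.lookup x∉ y∈)
    ... | inj₂ (there y∈vs) = ∈-++⁺ʳ us y∈vs

  n<[1+n/h]*h : ∀ n h .{{_ : NonZero h}} → n < suc (n / h) * h
  n<[1+n/h]*h n h = subst (_< suc (n / h) * h) (sym (m≡m%n+[m/n]*n n h)) (+-monoˡ-< (n / h * h) (m%n<n n h))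

  ^-distribʳ-* : ∀ i x y → (x * y) ^ i ≡ x ^ i * y ^ i
  ^-distribʳ-* zero    x y = refl
  ^-distribʳ-* (suc i) x y = trans (cong (x * y *_) (^-distribʳ-* i x y)) (ring x y (x ^ i) (y ^ i))
    where
    ring : ∀ x y u v → x * y * (u * v) ≡ x * u * (y * v)
    ring = solve-∀

  length-cartesianProductWith : ∀ {X Y Z : Set} (f : X → Y → Z) xs ys → length (cartesianProductWith f xs ys) ≡ length xs * length ys
  length-cartesianProductWith f []       ys = refl
  length-cartesianProductWith f (x ∷ xs) ys = trans (length-++ (map (f x) ys)) (cong₂ _+_ (length-map (f x) ys) (length-cartesianProductWith f xs ys))

  record Parameters (o E S N : ℕ) : Set where
    constructor parameters
    field
      D M L : ℕ
      {{D≢0}} : NonZero D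
    p = suc o
    k = suc p
    Λ = k * (p * D + M)
    field
      hM : k * N ^ p ≤ M * D ^ p
      hL : suc (Λ + (p + p)) * (p * N ^ o) < F p L
      hS : (2 * p * (E * L + (Λ + L) + 1) + o) * S ≤ N

  -- D = N / h and L ≈ g D.  The exponent p of g in hL exceeds by one that of h = c g, so a large constant g works.
  parameters-exist : ∀ o E S .{{_ : NonZero S}} → ∃ λ N₀ → ∀ N → N₀ ≤ N → Parameters o E S N
  -- This threshold forces D > M, so that the constant `M` inside Λ can be absorbed into `D`.
  parameters-exist o E S = suc M * h , λ N N₀≤N → build N N₀≤N
    where
    p = suc o
    k = suc p
    -- Obtained by replacing, in the bracket of `hS`, `L` by `suc p` and Λ by `k * k`, their bounds
    -- in units of `g * D`. With h = q S g the condition becomes D h ≤ N.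
    q = 2 * p * (E * suc p + (k * k + suc p) + 1) + o
    c₀ = q * S
    B = suc (k * k + (p + p)) * p
    g = suc (B * (2 * c₀) ^ o)
    h = c₀ * g
    -- Exactly what `hM` requires, since N ≤ 2 h D.
    M = k * (2 * h) ^ p
    instance
      h≢0 : NonZero h
      h≢0 = m*n≢0 c₀ g {{m*n≢0 q S {{>-nonZero q>0}}}}
        where
        q>0 : 0 < q
        q>0 = ≤-trans (s≤s z≤n) (≤-trans (m≤n*m 1 (2 * p)) (≤-trans (*-monoʳ-≤ (2 * p) (m≤n+m 1 (E * suc p + (k * k + suc p)))) (m≤m+n _ o)))
    build : ∀ N → suc M * h ≤ N → Parameters o E S N
    build N N₀≤N = parameters D M L {{D≢0}} hM hL hS
      where
      open ≤-Reasoning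
      D = N / h
      -- The shift by `p` makes `F p L` at least the pure power of `g * D`.
      L = g * D + p
      Λ = k * (p * D + M)
      M<D : suc M ≤ D
      M<D = ≤-trans (≤-reflexive (sym (m*n/n≡m (suc M) h))) (/-monoˡ-≤ h N₀≤N)
      1≤D : 1 ≤ D
      1≤D = ≤-trans (s≤s z≤n) M<D
      D≢0 : NonZero D
      D≢0 = >-nonZero 1≤D
      N≤ : N ≤ 2 * h * D
      N≤ = begin
        N               ≤⟨ <⇒≤ (n<[1+n/h]*h N h) ⟩
        suc D * h       ≤⟨ *-monoˡ-≤ h (+-monoˡ-≤ D 1≤D) ⟩
        (D + D) * h     ≡⟨ ring D h ⟩
        2 * h * D       ∎
        where
        ring : ∀ D h → (D + D) * h ≡ 2 * h * D
        ring = solve-∀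
      N^≤ : ∀ i → N ^ i ≤ (2 * h) ^ i * D ^ i
      N^≤ i = ≤-trans (^-monoˡ-≤ i N≤) (≤-reflexive (^-distribʳ-* i (2 * h) D))
      hM : k * N ^ p ≤ M * D ^ p
      hM = ≤-trans (*-monoʳ-≤ k (N^≤ p)) (≤-reflexive (sym (*-assoc k ((2 * h) ^ p) (D ^ p))))
      scale : ∀ x → x ≤ x * D
      scale x = m≤m*n x D {{D≢0}}
      Λ≤ : Λ ≤ k * k * D
      Λ≤ = begin
        k * (p * D + M)   ≤⟨ *-monoʳ-≤ k (+-monoʳ-≤ (p * D) (<⇒≤ M<D)) ⟩
        k * (p * D + D)   ≡⟨ ring k p D ⟩
        k * suc p * D     ∎
        where
        ring : ∀ k p D → k * (p * D + D) ≡ k * suc p * D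
        ring = solve-∀
      hL : suc (Λ + (p + p)) * (p * N ^ o) < F p L
      hL = begin-strict
        suc (Λ + (p + p)) * (p * N ^ o)
          ≤⟨ *-mono-≤ (+-mono-≤ 1≤D (+-mono-≤ Λ≤ (scale (p + p)))) (*-monoʳ-≤ p (N^≤ o)) ⟩
        (D + (k * k * D + (p + p) * D)) * (p * ((2 * h) ^ o * D ^ o))
          ≡⟨ ring₁ D (k * k) (p + p) p ((2 * h) ^ o) (D ^ o) ⟩
        B * (2 * h) ^ o * (D * D ^ o)
          ≡⟨ cong (λ z → B * z * (D * D ^ o)) (trans (cong (_^ o) (sym (*-assoc 2 c₀ g))) (^-distribʳ-* o (2 * c₀) g)) ⟩
        B * ((2 * c₀) ^ o * g ^ o) * (D * D ^ o)
          ≡⟨ cong (_* (D * D ^ o)) (sym (*-assoc B ((2 * c₀) ^ o) (g ^ o))) ⟩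
        B * (2 * c₀) ^ o * g ^ o * D ^ p
          <⟨ *-monoˡ-< (D ^ p) {{m^n≢0 D p {{D≢0}}}} (*-monoˡ-< (g ^ o) {{m^n≢0 g o}} (n<1+n (B * (2 * c₀) ^ o))) ⟩
        g ^ p * D ^ p
          ≡⟨ ^-distribʳ-* p g D ⟨
        (g * D) ^ p
          ≤⟨ ^≤F p (g * D) ⟩
        F p L ∎
        where
        ring₁ : ∀ D K P p H X → (D + (K * D + P * D)) * (p * (H * X)) ≡ suc (K + P) * p * H * (D * X)
        ring₁ = solve-∀
      gscale : ∀ x → x ≤ x * (g * D)
      gscale x = m≤m*n x (g * D) {{m*n≢0 g D {{_}} {{D≢0}}}}
      L≤ : L ≤ suc p * (g * D)
      L≤ = +-monoʳ-≤ (g * D) (gscale p)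
      Λ≤′ : Λ ≤ k * k * (g * D)
      Λ≤′ = ≤-trans Λ≤ (*-monoʳ-≤ (k * k) (m≤n*m D g))
      hS : (2 * p * (E * L + (Λ + L) + 1) + o) * S ≤ N
      hS = begin
        (2 * p * (E * L + (Λ + L) + 1) + o) * S
          ≤⟨ *-monoˡ-≤ S (+-mono-≤ (*-monoʳ-≤ (2 * p) (+-mono-≤ (+-mono-≤ (*-monoʳ-≤ E L≤) (+-mono-≤ Λ≤′ L≤)) (gscale 1))) (gscale o)) ⟩
        (2 * p * (E * (suc p * u) + (k * k * u + suc p * u) + 1 * u) + o * u) * S
          ≡⟨ ring (2 * p) E (suc p) (k * k) o (g * D) S ⟩
        q * S * u
          ≡⟨ trans (sym (*-assoc c₀ g D)) (*-comm h D) ⟩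
        D * h
          ≤⟨ m/n*n≤m N h ⟩
        N ∎
        where
        u = g * D
        ring : ∀ P E s K o u S → (P * (E * (s * u) + (K * u + s * u) + 1 * u) + o * u) * S ≡ (P * (E * s + (K + s) + 1) + o) * S * u
        ring = solve-∀

  -- Density of the exceptional m

  C≤^ : ∀ x i → x C i ≤ x ^ i
  C≤^ x i = ≤-trans (m≤n*m (x C i) (i !) {{i !≢0}}) (≤-trans (≤-reflexive (!*C≡F i x)) (F≤^ i x))

  -- The remainder is confined to about (N/S)^o values out of the order N^o that the leading terms
  -- permit, which makes these m rare.
  record Sparse (o S m : ℕ) .{{_ : NonZero S}} : Set where
    constructor sparse
    field
      {N b r} : ℕ
      b<N : b < N
      r<  : r < suc (N / S) ^ o
      m≡  : m ≡ N C suc (suc o) + b C suc o + r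

  record Dense (o S m kk : ℕ) : Set where
    constructor dense
    field
      {N b s} : ℕ
      {l}     : List ℕ
      canon   : CanonRep (suc (suc o)) m (N ∷ b ∷ s ∷ l)
      kk≡     : kk ≡ repSum 1 (suc (suc o)) (N ∷ b ∷ s ∷ l)
      N≤sS    : N ≤ s * S

  sparse-or-dense : ∀ o₀ S .{{_ : NonZero S}} m kk → let o = suc o₀ in IsKK (suc (suc o)) m kk → Sparse o S m ⊎ Dense o S m kk
  sparse-or-dense o₀ S m kk (N ∷ [] , (_ , _ , _ , last , m≡) , kk≡) =
    -- With a single canonical term, b = 0 serves as a second entry, since `0 C suc o` is 0.
    inj₁ (sparse {b = 0} {r = 0} (≤-trans (s≤s z≤n) last) (m^n>0 (suc (N / S)) (suc o₀))
      (trans m≡ (trans (cong (λ z → N C suc (suc (suc z)) + 0) (+-identityʳ o₀)) (sym (+-identityʳ (N C suc (suc (suc o₀)) + 0))))))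
  sparse-or-dense o₀ S m kk (N ∷ b ∷ [] , (_ , _ , (b<N ∷ _) , _ , m≡) , kk≡) =
    inj₁ (sparse {r = 0} b<N (m^n>0 (suc (N / S)) (suc o₀))
      (trans m≡ (trans (cong (λ z → N C suc (suc z) + (b C suc z + 0)) (+-identityʳ (suc o₀))) (sym (+-assoc (N C suc (suc (suc o₀))) _ 0)))))
  sparse-or-dense o₀ S m kk (N ∷ b ∷ s ∷ l , canon@(_ , s≤s (s≤s len) , (b<N ∷ (s<b ∷ dec)) , last , m≡) , kk≡) with N ≤? s * S
  ... | yes N≤ = inj₂ (dense canon kk≡ N≤)
  ... | no N≰ = inj₁ (sparse b<N r<
      (trans m≡ (trans (cong (λ z → N C suc (suc z) + (b C suc z + repSum 0 o (s ∷ l))) (+-identityʳ o)) (sym (+-assoc (N C suc (suc o)) _ _)))))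
    where
    o = suc o₀
    s≤N/S : s ≤ N / S
    s≤N/S = ≤-trans (≤-reflexive (sym (m*n/n≡m s S))) (/-monoˡ-≤ S (≰⇒≥ N≰))
    r< : repSum 0 o (s ∷ l) < suc (N / S) ^ o
    r< = <-≤-trans (proj₂ (rep-bound o s l len dec last)) (≤-trans (C≤^ (suc s) o) (^-monoˡ-≤ o (s≤s s≤N/S)))

  dense-ratio-small : ∀ o₀ E S .{{_ : NonZero S}} m kk lg con → let o = suc o₀ ; k = suc (suc o) in
    (D : Dense o S m kk) → IsLG k m lg → IsCON k m con → Parameters o E S (Dense.N D) →
    con < kk × E * lg + con ≤ E * con + kk
  dense-ratio-small o₀ E S m kk lg con (dense {N} {b} {s} {l} canon kk≡ N≤sS) isLG isCON P =
    Good.ratio-small o₀ N b s l m kk lg con canon kk≡ isLG isCON E D M L hM hL (*-cancelʳ-≤ _ s S (≤-trans hS N≤sS))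
    where open Parameters P

  -- All k factors on the left are at most 2 (N - k) even after one factor `v` has absorbed `S`.
  -- That factor is present because the exponent o = k - 2 is positive. For the other factors `v` no
  -- saving is claimed.
  sparse-count : ∀ o₀ S .{{_ : NonZero S}} N → let o = suc o₀ ; k = suc (suc o) in k + (k + S) ≤ N →
    S * (suc N * suc N * suc (N / S) ^ o) ≤ 2 ^ k * k ! * (N C k)
  sparse-count o₀ S N h = begin
    S * (suc N * suc N * (v * v ^ o₀))        ≡⟨ ring₁ S (suc N) v (v ^ o₀) ⟩
    suc N * (suc N * (S * v * v ^ o₀))        ≤⟨ *-mono-≤ N<2x (*-mono-≤ N<2x (*-mono-≤ Sv≤ (^-monoˡ-≤ o₀ (≤-trans (m≤n*m v S) Sv≤)))) ⟩
    (2 * x) ^ k                               ≡⟨ ^-distribʳ-* k 2 x ⟩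
    2 ^ k * x ^ k                             ≤⟨ *-monoʳ-≤ (2 ^ k) (^≤F k x) ⟩
    2 ^ k * F k (x + k)                       ≡⟨ cong (λ z → 2 ^ k * F k z) N≡ ⟩
    2 ^ k * F k N                             ≡⟨ cong (2 ^ k *_) (!*C≡F k N) ⟨
    2 ^ k * (k ! * (N C k))                   ≡⟨ *-assoc (2 ^ k) (k !) (N C k) ⟨
    2 ^ k * k ! * (N C k)                     ∎
    where
    open ≤-Reasoning
    k = suc (suc (suc o₀))
    x = N ∸ k
    v = suc (N / S)
    N≡ : x + k ≡ N
    N≡ = m∸n+n≡m (≤-trans (m≤m+n k (k + S)) h)
    x≥ : k + S ≤ x
    x≥ = ≤-trans (≤-reflexive (sym (m+n∸m≡n k (k + S)))) (∸-monoˡ-≤ k h)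
    2x≡ : x + x ≡ 2 * x
    2x≡ = cong (_+_ x) (sym (+-identityʳ x))
    ring₁ : ∀ S n v w → S * (n * n * (v * w)) ≡ n * (n * (S * v * w))
    ring₁ = solve-∀
    N+S≤ : N + S ≤ 2 * x
    N+S≤ = begin
      N + S           ≡⟨ cong (_+ S) N≡ ⟨
      x + k + S       ≡⟨ +-assoc x k S ⟩
      x + (k + S)     ≤⟨ +-monoʳ-≤ x x≥ ⟩
      x + x           ≡⟨ 2x≡ ⟩
      2 * x           ∎
    N<2x : suc N ≤ 2 * x
    N<2x = ≤-trans (≤-trans (≤-reflexive (+-comm 1 N)) (+-monoʳ-≤ N (>-nonZero⁻¹ S))) N+S≤
    Sv≤ : S * v ≤ 2 * x
    Sv≤ = begin
      S * suc (N / S)    ≡⟨ *-comm S v ⟩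
      S + N / S * S      ≡⟨ +-comm S _ ⟩
      N / S * S + S      ≤⟨ +-monoˡ-≤ S (m/n*n≤m N S) ⟩
      N + S              ≤⟨ N+S≤ ⟩
      2 * x              ∎

  -- The exceptional m up to a given bound

  module Density (o₀ : ℕ) (LG KK CON : ℕ → ℕ)
    (isLG : ∀ m → 1 ≤ m → IsLG (suc (suc (suc o₀))) m (LG m))
    (isKK : ∀ m → 1 ≤ m → IsKK (suc (suc (suc o₀))) m (KK m))
    (isCON : ∀ m → 1 ≤ m → IsCON (suc (suc (suc o₀))) m (CON m))
    (a dε : ℕ) .(cop : Coprime (suc a) (suc dε))
    (S : ℕ) .{{S≢0 : NonZero S}} (N₀ : ℕ) (params : ∀ N → N₀ ≤ N → Parameters (suc o₀) (suc dε) S N) where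

    o p k : ℕ
    o = suc o₀
    p = suc o
    k = suc p

    ε : ℚ
    ε = mkℚ +[1+ a ] dε cop

    B₀ : ℕ
    B₀ = N₀ C k

    exceptional : ∀ m → 1 ≤ m → ε <ℚ ρ (LG m) (KK m) (CON m) → m < B₀ ⊎ Sparse o S m
    exceptional m m≥1 ε<ρ with sparse-or-dense o₀ S m (KK m) (isKK m m≥1)
    ... | inj₁ sp = inj₂ sp
    ... | inj₂ dn with N₀ ≤? Dense.N dn
    ...   | yes N₀≤N = contradiction ε<ρ (ρ-small a dε cop (LG m) (KK m) (CON m) (proj₁ small) (proj₂ small))
      where small = dense-ratio-small o₀ (suc dε) S m (KK m) (LG m) (CON m) dn (isLG m m≥1) (isCON m m≥1)
                      (params (Dense.N dn) N₀≤N)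
    exceptional m m≥1 ε<ρ | inj₂ (dense {N} {b} {s} {l} canon@(_ , len , dec , last , m≡) _ _) | no N₀≰N =
      inj₁ (<-≤-trans (subst (_< suc N C k) (sym m≡) (proj₂ (rep-bound k N (b ∷ s ∷ l) len dec last))) (C-mono k (≰⇒> N₀≰N)))

    -- Repetitions are harmless, since the length serves only as an upper bound.
    exceptions : ℕ → List ℕ
    exceptions N = upTo B₀ ++ cartesianProductWith _+_
      (cartesianProductWith (λ n b → n C k + b C p) (upTo (suc N)) (upTo (suc N))) (upTo (suc (N / S) ^ o))

    length-exceptions : ∀ N → length (exceptions N) ≡ B₀ + suc N * suc N * suc (N / S) ^ o
    length-exceptions N = trans (length-++ (upTo B₀)) (cong₂ _+_ (length-upTo B₀)
      (trans (length-cartesianProductWith _+_ pairs (upTo (suc (N / S) ^ o))) (cong₂ _*_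
        (trans (length-cartesianProductWith (λ n b → n C k + b C p) (upTo (suc N)) (upTo (suc N)))
          (cong₂ _*_ (length-upTo (suc N)) (length-upTo (suc N))))
        (length-upTo (suc (N / S) ^ o)))))
      where pairs = cartesianProductWith (λ n b → n C k + b C p) (upTo (suc N)) (upTo (suc N))

    sparse∈exceptions : ∀ {m N} → m < suc N C k → Sparse o S m → m ∈ exceptions N
    sparse∈exceptions {m} {N} m< (sparse {n} {b} {r} b<n r< refl) = ∈-++⁺ʳ (upTo B₀)
      (∈-cartesianProductWith⁺ _+_
        (∈-cartesianProductWith⁺ (λ n b → n C k + b C p) (∈-upTo⁺ (s≤s n≤N)) (∈-upTo⁺ (≤-trans b<n (m≤n⇒m≤1+n n≤N))))
        (∈-upTo⁺ (<-≤-trans r< (^-monoˡ-≤ o (s≤s (/-monoˡ-≤ S n≤N))))))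
      where
      n≤N : n ≤ N
      n≤N = ≮⇒≥ λ N<n → <⇒≱ m< (≤-trans (C-mono k N<n) (≤-trans (m≤m+n (n C k) _) (≤-reflexive (sym (+-assoc (n C k) (b C p) r)))))

    count≤ : ∀ j N → suc j < suc N C k → countBig LG KK CON ε (suc j) ≤ B₀ + suc N * suc N * suc (N / S) ^ o
    count≤ j N j< = ≤-trans
      (unique-length≤ (Unique.filter⁺ P? (Unique.map⁺ suc-injective (Unique.upTo⁺ (suc j)))) member)
      (≤-reflexive (length-exceptions N))
      where
      P? = λ m → ε <ℚ? ρ (LG m) (KK m) (CON m)
      member : ∀ {m} → m ∈ filter P? (map suc (upTo (suc j))) → m ∈ exceptions N
      member m∈ with ∈-filter⁻ P? {xs = map suc (upTo (suc j))} m∈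
      ... | m∈′ , big with ∈-map⁻ suc m∈′
      ...   | i , i∈ , refl with exceptional (suc i) (s≤s z≤n) big
      ...     | inj₁ m<B₀ = ∈-++⁺ˡ (∈-upTo⁺ m<B₀)
      ...     | inj₂ sp = sparse∈exceptions (≤-<-trans (∈-upTo⁻ i∈) j<) sp

    module _ (Δ T : ℕ) .{{T≢0 : NonZero T}} (T≡ : T ≡ 2 ^ k * k !) (S≡ : S ≡ 2 * Δ * T) where

      -- The binomial coefficient makes the leading entry of `suc j` large enough for
      -- `sparse-count`; the other summand keeps the m below `B₀` to less than half of the
      -- allowance.
      threshold : ℕ
      threshold = (k + (k + S)) C k + 2 * Δ * B₀

      count-small : ∀ j → threshold ≤ j → Δ * countBig LG KK CON ε (suc j) < suc j
      -- The witness of `isLG` supplies a leading entry `N` for `suc j` itself, and the list of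
      -- exceptions is taken for this `N`.
      count-small j J≤j = bound (isLG (suc j) (s≤s z≤n))
        where
        open ≤-Reasoning
        bound : IsLG k (suc j) (LG (suc j)) → Δ * countBig LG KK CON ε (suc j) < suc j
        bound (N , b , as , rep , _) = *-cancelˡ-< 2 _ _ (begin-strict
          2 * (Δ * countBig LG KK CON ε (suc j))   ≡⟨ *-assoc 2 Δ _ ⟨
          2 * Δ * countBig LG KK CON ε (suc j)     ≤⟨ *-monoʳ-≤ (2 * Δ) (count≤ j N j<) ⟩
          2 * Δ * (B₀ + A)                         ≡⟨ *-distribˡ-+ (2 * Δ) B₀ A ⟩
          2 * Δ * B₀ + 2 * Δ * A                   <⟨ +-mono-<-≤ (s≤s (≤-trans (m≤n+m (2 * Δ * B₀) _) J≤j)) A≤ ⟩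
          suc j + suc j                            ≡⟨ cong (_+_ (suc j)) (+-identityʳ (suc j)) ⟨
          2 * suc j                                ∎)
          where
          lead : Leading o (suc j) N b (repSum 0 p as)
          lead = secondRep-leading o (suc j) N b as rep
          j< : suc j < suc N C k
          j< = leading-< lead
          N-large : k + (k + S) ≤ N
          N-large = ≮⇒≥ λ N< → <⇒≱ j< (≤-trans (C-mono k N<) (≤-trans (m≤m+n _ (2 * Δ * B₀)) (≤-trans J≤j (n≤1+n j))))
          A = suc N * suc N * suc (N / S) ^ o
          -- The reason for S = 2 Δ T: after cancelling `T`, the sparse m take up at most the other
          -- half.
          A≤ : 2 * Δ * A ≤ suc j
          A≤ = *-cancelˡ-≤ T (begin
            T * (2 * Δ * A)          ≡⟨ trans (sym (*-assoc T (2 * Δ) A)) (cong (_* A) (*-comm T (2 * Δ))) ⟩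
            2 * Δ * T * A            ≡⟨ cong (_* A) S≡ ⟨
            S * A                    ≤⟨ sparse-count o₀ S N N-large ⟩
            2 ^ k * k ! * (N C k)    ≡⟨ cong (_* (N C k)) T≡ ⟨
            T * (N C k)              ≤⟨ *-monoʳ-≤ T (leading-≥ lead) ⟩
            T * suc j                ∎)

  density-zero : ∀ o₀ → let k = suc (suc (suc o₀)) in (LG KK CON : ℕ → ℕ) →
    (∀ m → 1 ≤ m → IsLG k m (LG m)) → (∀ m → 1 ≤ m → IsKK k m (KK m)) → (∀ m → 1 ≤ m → IsCON k m (CON m)) →
    (ε : ℚ) → 0ℚ <ℚ ε → (δ : ℚ) → 0ℚ <ℚ δ →
    ∃ λ J → ∀ j → J ≤ j → (pos (countBig LG KK CON ε (suc j)) /ℚ suc j) <ℚ δ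
  density-zero _ _ _ _ _ _ _ (mkℚ (pos 0) _ _)    (*<* (+<+ ()))
  density-zero _ _ _ _ _ _ _ (mkℚ -[1+ _ ] _ _) (*<* ())
  density-zero _ _ _ _ _ _ _ (mkℚ +[1+ _ ] _ _) _ (mkℚ (pos 0) _ _)    (*<* (+<+ ()))
  density-zero _ _ _ _ _ _ _ (mkℚ +[1+ _ ] _ _) _ (mkℚ -[1+ _ ] _ _) (*<* ())
  density-zero o₀ LG KK CON isLG isKK isCON (mkℚ +[1+ a ] dε copε) _ (mkℚ +[1+ b ] dδ copδ) _ =
    choose (2 ^ k * k !) {{m*n≢0 (2 ^ k) (k !) {{m^n≢0 2 k}} {{k !≢0}}}} refl _ refl
    where
    k = suc (suc (suc o₀))
    Δ = suc dδ
    -- T and S are variables here so that 2 ^ k * k ! is never unfolded.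
    choose : ∀ T .{{_ : NonZero T}} → T ≡ 2 ^ k * k ! → ∀ S → S ≡ 2 * Δ * T →
      ∃ λ J → ∀ j → J ≤ j → (pos (countBig LG KK CON (mkℚ +[1+ a ] dε copε) (suc j)) /ℚ suc j) <ℚ mkℚ +[1+ b ] dδ copδ
    choose T T≡ S S≡ = threshold Δ T T≡ S≡ , λ j J≤j → fraction-< b dδ copδ _ j (count-small Δ T T≡ S≡ j J≤j)
      where
      instance
        S≢0 : NonZero S
        S≢0 = subst NonZero (sym S≡) (m*n≢0 (2 * Δ) T)
      exists = parameters-exist (suc o₀) (suc dε) S
      open Density o₀ LG KK CON isLG isKK isCON a dε copε S (proj₁ exists) (proj₂ exists)

open import Defs
open import Data.Nat using (ℕ; suc; _≤_)
open import Data.Integer using (+_)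
open import Data.Rational using (ℚ; 0ℚ; _<_; _/_)
open import Data.Product using (∃)

theorem4p6 : (k : ℕ) → 3 ≤ k → (ε : ℚ) → 0ℚ < ε →
    (LG KK CON : ℕ → ℕ) →
    (∀ m → 1 ≤ m → IsLG k m (LG m)) →
    (∀ m → 1 ≤ m → IsKK k m (KK m)) →
    (∀ m → 1 ≤ m → IsCON k m (CON m)) →
    (δ : ℚ) → 0ℚ < δ →
    ∃ λ J → ∀ j → J ≤ j → ((+ countBig LG KK CON ε (suc j)) / suc j) < δ
theorem4p6 (suc (suc (suc o₀))) _ ε ε>0 LG KK CON isLG isKK isCON δ δ>0 =
  CliqueDensity.density-zero o₀ LG KK CON isLG isKK isCON ε ε>0 δ δ>0
theorem4p6 1 (_≤_.s≤s ())
theorem4p6 2 (_≤_.s≤s (_≤_.s≤s ()))
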